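{- Let $(K,<)$ be an ordered field, let $v_{\mathrm{nat}}$ be its natural valuation and let $G := v_{\mathrm{nat}}(K^\times)$. Let $H \subseteq G$ be an $\mathcal{L}_{\mathrm{og}}$-definable convex subgroup of $G$ such that $G_0 \subsetneq H$, where $G_0$ is the maximal divisible convex subgroup of $G$. Then the coarsening $\Phi_K^{ -1}(H)$ of $v_{\mathrm{nat}}$ corresponding to $H$ is $\mathcal{L}_{\mathrm{or}}$-definable in $K$ (that is, its valuation ring is $\mathcal{L}_{\mathrm{or}}$-definable).
   Context: All orderings are linear. $\mathcal{L}_{\mathrm{or}} = \{+,-,\cdot,0,1,<\}$ is the language of ordered rings and $\mathcal{L}_{\mathrm{og}}=\{+,-,0,<\}$ the language of ordered groups. "Definable" means first-order definable with parameters from the structure. A valuation $w$ on an ordered field $(K,<)$ has valuation ring $\mathcal{O}_w=\{a \mid w(a)\ge 0\}$ and valuation ideal $\mathcal{I}_w = \{a\mid w(a)>0\}$; it is called convex if $\mathcal{O}_w$ is convex in $(K,<)$, and definable if $\mathcal{O}_w$ is definable. The natural valuation $v_{\mathrm{nat}}$ is the finest convex valuation on $(K,<)$; its valuation ring is $\{a\in K \mid |a|\le n \text{ for some } n\in\mathbb{N}\}$. The convex valuations are exactly the coarsenings of $v_{\mathrm{nat}}$. The map $\Phi_K\colon \mathcal{O}_v \mapsto v_{\mathrm{nat}}(\mathcal{O}_v\setminus\mathcal{I}_v)$ is an inclusion-preserving bijection from the set of non-trivial convex valuation rings of $K$ (those $\neq K$) to the set of proper convex subgroups of $G$, and $\Phi_K^{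 -1}(H)$ is the valuation ring $\{a \in K \mid v_{\mathrm{nat}}(a) > 0 \text{ or } v_{\mathrm{nat}}(a) \in H\}$; for $H=G$ this is read as the trivial valuation ring $K$. -}

module Defs where

open import Algebra.Bundles using (AbelianGroup; CommutativeRing)
import Algebra.Definitions.RawMonoid as RawMonoidDefinitions
open import Data.Fin.Base using (Fin)
open import Data.Nat.Base using (ℕ; suc)
open import Data.Product.Base using (_×_; ∃-syntax; Σ-syntax)
open import Data.Sum.Base using (_⊎_)
open import Data.Vec.Base using (Vec; _∷_; lookup)
open import Function.Bundles using (_⇔_)
open import Level using (Level) renaming (suc to lsuc)
open import Relation.Binary.Core using (Rel)
import Relation.Binary.Construct.Add.Supremum.Equality as SupEquality
import Relation.Binary.Construct.Add.Supremum.NonStrict as SupNonStrict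
import Relation.Binary.Construct.Add.Supremum.Strict as SupStrict
import Relation.Binary.Construct.StrictToNonStrict as StrictToNonStrict
open import Relation.Binary.Structures using (IsStrictTotalOrder)
open import Relation.Nullary.Construct.Add.Supremum using (_⁺; [_]; ⊤⁺)
open import Relation.Nullary.Negation.Core using (¬_)
open import Relation.Unary using (Pred; _⊆_; _∈_)

private
  variable
    ℓ : Level
    n : ℕ

record OrderedAbelianGroup (ℓ : Level) : Set (lsuc ℓ) where
  infix 4 _<_
  field
    abelianGroup : AbelianGroup ℓ ℓ

  open AbelianGroup abelianGroup public
    renaming (_∙_ to _+_; ε to 0#; _⁻¹ to -_)

  field
    _<_                : Rel Carrier ℓ
    isStrictTotalOrder : IsStrictTotalOrder _≈_ _<_
    +-monoʳ-<          : ∀ x {y z} → y < z → x + y < x + z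

  open StrictToNonStrict _≈_ _<_ public using (_≤_)
  open RawMonoidDefinitions rawMonoid public using () renaming (_×_ to _·_)

record OrderedField (ℓ : Level) : Set (lsuc ℓ) where
  infix 4 _<_
  field
    commutativeRing : CommutativeRing ℓ ℓ

  open CommutativeRing commutativeRing public

  field
    0≉1                : ¬ (0# ≈ 1#)
    inverse            : ∀ x → ¬ (x ≈ 0#) → ∃[ y ] x * y ≈ 1#
    _<_                : Rel Carrier ℓ
    isStrictTotalOrder : IsStrictTotalOrder _≈_ _<_
    +-monoʳ-<          : ∀ x {y z} → y < z → x + y < x + z
    *-pos              : ∀ {x y} → 0# < x → 0# < y → 0# < x * y

-- First-order formulas, with de Bruijn variables, over a language whose only
-- relation symbol is < ; T n is the set of its terms in n variables.

infix  8 _≐_ _≺_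
infixr 7 _∧̇_
infixr 6 _∨̇_
infixr 5 _⇒̇_

data Formula (T : ℕ → Set) : ℕ → Set where
  _≐_ _≺_          : T n → T n → Formula T n
  ¬̇_               : Formula T n → Formula T n
  _∧̇_ _∨̇_ _⇒̇_      : Formula T n → Formula T n → Formula T n
  ∀̇_ ∃̇_            : Formula T (suc n) → Formula T n

module Semantics
  {A : Set ℓ} (_≈_ _<_ : Rel A ℓ)
  {T : ℕ → Set} (⟦_⟧ : ∀ {n} → T n → Vec A n → A)
  where

  infix 4 _⊨_

  _⊨_ : Vec A n → Formula T n → Set ℓ
  ρ ⊨ s ≐ t = ⟦ s ⟧ ρ ≈ ⟦ t ⟧ ρ
  ρ ⊨ s ≺ t = ⟦ s ⟧ ρ < ⟦ t ⟧ ρ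
  ρ ⊨ ¬̇ φ   = ¬ (ρ ⊨ φ)
  ρ ⊨ φ ∧̇ ψ = (ρ ⊨ φ) × (ρ ⊨ ψ)
  ρ ⊨ φ ∨̇ ψ = (ρ ⊨ φ) ⊎ (ρ ⊨ ψ)
  ρ ⊨ φ ⇒̇ ψ = (ρ ⊨ φ) → (ρ ⊨ ψ)
  ρ ⊨ ∀̇ φ   = ∀ a → a ∷ ρ ⊨ φ
  ρ ⊨ ∃̇ φ   = ∃[ a ] a ∷ ρ ⊨ φ

  -- Variable 0 ranges over the defined set; the other variables are
  -- interpreted by the parameters.
  Definable : Pred A ℓ → Set ℓ
  Definable P = ∃[ m ] Σ[ φ ∈ Formula T (suc m) ] Σ[ params ∈ Vec A m ]
                (∀ a → P a ⇔ (a ∷ params ⊨ φ))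

data OgTerm (n : ℕ) : Set where
  var   : Fin n → OgTerm n
  _⊕_   : OgTerm n → OgTerm n → OgTerm n
  ⊖_    : OgTerm n → OgTerm n
  𝟎     : OgTerm n

data OrTerm (n : ℕ) : Set where
  var     : Fin n → OrTerm n
  _⊕_ _⊗_ : OrTerm n → OrTerm n → OrTerm n
  ⊖_      : OrTerm n → OrTerm n
  𝟎 𝟏     : OrTerm n

module _ (G : OrderedAbelianGroup ℓ) where
  open OrderedAbelianGroup G

  ⟦_⟧og : OgTerm n → Vec Carrier n → Carrier
  ⟦ var i ⟧og ρ = lookup ρ i
  ⟦ s ⊕ t ⟧og ρ = ⟦ s ⟧og ρ + ⟦ t ⟧og ρ
  ⟦ ⊖ t ⟧og   ρ = - ⟦ t ⟧og ρ
  ⟦ 𝟎 ⟧og     ρ = 0#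

  OgDefinable : Pred Carrier ℓ → Set ℓ
  OgDefinable = Semantics.Definable _≈_ _<_ ⟦_⟧og

module _ (K : OrderedField ℓ) where
  open OrderedField K

  ⟦_⟧or : OrTerm n → Vec Carrier n → Carrier
  ⟦ var i ⟧or ρ = lookup ρ i
  ⟦ s ⊕ t ⟧or ρ = ⟦ s ⟧or ρ + ⟦ t ⟧or ρ
  ⟦ s ⊗ t ⟧or ρ = ⟦ s ⟧or ρ * ⟦ t ⟧or ρ
  ⟦ ⊖ t ⟧or   ρ = - ⟦ t ⟧or ρ
  ⟦ 𝟎 ⟧or     ρ = 0#
  ⟦ 𝟏 ⟧or     ρ = 1#

  OrDefinable : Pred Carrier ℓ → Set ℓ
  OrDefinable = Semantics.Definable _≈_ _<_ ⟦_⟧or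

Convex : {A : Set ℓ} → Rel A ℓ → Pred A ℓ → Set ℓ
Convex _<_ P = ∀ {x y z} → x ∈ P → z ∈ P → x < y → y < z → y ∈ P

module _ (G : OrderedAbelianGroup ℓ) where
  open OrderedAbelianGroup G

  record IsConvexSubgroup (H : Pred Carrier ℓ) : Set ℓ where
    field
      resp-≈     : ∀ {x y} → x ≈ y → x ∈ H → y ∈ H
      0∈         : 0# ∈ H
      +-closed   : ∀ {x y} → x ∈ H → y ∈ H → x + y ∈ H
      neg-closed : ∀ {x} → x ∈ H → - x ∈ H
      convex     : Convex _<_ H

  IsDivisible : Pred Carrier ℓ → Set ℓ
  IsDivisible D = ∀ n {x} → x ∈ D → ∃[ y ] (y ∈ D × suc n · y ≈ x)

  record IsMaximalDivisibleConvexSubgroup (D : Pred Carrier ℓ) : Set (lsuc ℓ) where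
    field
      isConvexSubgroup : IsConvexSubgroup D
      isDivisible      : IsDivisible D
      maximal          : ∀ {E} → IsConvexSubgroup E → IsDivisible E → D ⊆ E → E ⊆ D

module ExtendedGroup (G : OrderedAbelianGroup ℓ) where
  open OrderedAbelianGroup G

  -- G ∪ {∞}
  G∞ : Set ℓ
  G∞ = Carrier ⁺

  pattern ∞ = ⊤⁺

  open SupEquality _≈_ public using () renaming (_≈⁺_ to _≈∞_)
  open SupStrict _<_ public using () renaming (_<⁺_ to _<∞_)
  open SupNonStrict _≤_ public using () renaming (_≤⁺_ to _≤∞_)

  infixl 6 _+∞_

  _+∞_ : G∞ → G∞ → G∞
  [ g ] +∞ [ h ] = [ g + h ]
  [ g ] +∞ ∞     = ∞
  ∞     +∞ _     = ∞

-- Surjectivity says that G is the value group v(K^×).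
record Valuation (K : OrderedField ℓ) (G : OrderedAbelianGroup ℓ) : Set ℓ where
  open OrderedField K
  open ExtendedGroup G
  field
    val        : Carrier → G∞
    val-cong   : ∀ {x y} → x ≈ y → val x ≈∞ val y
    val-∞      : ∀ x → val x ≈∞ ∞ ⇔ x ≈ 0#
    val-*      : ∀ x y → val (x * y) ≈∞ val x +∞ val y
    val-+      : ∀ x y → val x ≤∞ val (x + y) ⊎ val y ≤∞ val (x + y)
    surjective : ∀ g → ∃[ x ] val x ≈∞ [ g ]

  ValuationRing : Pred Carrier ℓ
  ValuationRing x = [ OrderedAbelianGroup.0# G ] ≤∞ val x

module _ (K : OrderedField ℓ) where
  open OrderedField K

  record IsConvexValuationRing (O : Pred Carrier ℓ) : Set ℓ where
    field
      resp-≈     : ∀ {x y} → x ≈ y → x ∈ O → y ∈ O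
      0∈         : 0# ∈ O
      1∈         : 1# ∈ O
      +-closed   : ∀ {x y} → x ∈ O → y ∈ O → x + y ∈ O
      neg-closed : ∀ {x} → x ∈ O → - x ∈ O
      *-closed   : ∀ {x y} → x ∈ O → y ∈ O → x * y ∈ O
      x∈⊎x⁻¹∈    : ∀ {x y} → x * y ≈ 1# → x ∈ O ⊎ y ∈ O
      convex     : Convex _<_ O

module _ {K : OrderedField ℓ} {G : OrderedAbelianGroup ℓ} (v : Valuation K G) where
  open OrderedField K using (Carrier; _<_)
  open ExtendedGroup G
  open Valuation v

  -- v is the finest convex valuation. Valuations are compared through their
  -- valuation rings, which are exactly the subrings of K containing x or x⁻¹
  -- for each x ≠ 0.
  record IsNatural : Set (lsuc ℓ) where
    field
      convex : Convex _<_ ValuationRing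
      finest : ∀ {O} → IsConvexValuationRing K O → ValuationRing ⊆ O

  -- Φ_K⁻¹(H). For H = G this is all of K, as val 0 = ∞ > 0.
  CoarseningRing : Pred (OrderedAbelianGroup.Carrier G) ℓ → Pred Carrier ℓ
  CoarseningRing H a = ([ OrderedAbelianGroup.0# G ] <∞ val a)
                     ⊎ (∃[ h ] (h ∈ H × val a ≈∞ [ h ]))

{-# OPTIONS --safe #-}

-- Since H is not divisible, it contains some a that is not divisible by p in G
-- for some p ≥ 1. The elements of G whose translation preserves the cut a / p
-- form a convex subgroup D ⊆ H. As a / p is not in G, the cut lifts to
-- { x ∣ x^(2p) < α² } in K, where α has value a, and so the coarsening with value
-- group G / D is definable in K; a first-order formula over G / D then
-- translates into one over K.
--
-- It remains to define H / D in the ordered group G / D. If G were the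
-- lexicographic product of G / D and D, a Feferman–Vaught argument would turn
-- the definition of H in G into one of H / D in G / D. In general D is only a
-- pure subgroup, but every tuple of G is a sum u + d where d is a tuple of D and
-- u behaves, for linear forms from a finite list and modulo a fixed integer, as
-- if it generated a complement of D. This suffices for any given formula.
module Submission where

open import Defs
open import Algebra.Bundles using (CommutativeRing)
import Algebra.Properties.AbelianGroup as AbelianGroupProperties
import Algebra.Properties.CommutativeMonoid.Mult as Mult
import Algebra.Properties.CommutativeSemigroup as CommutativeSemigroupProperties
import Algebra.Properties.Ring as RingProperties
open import Axiom.ExcludedMiddle using (ExcludedMiddle)
open import Data.Bool.Base using (Bool; true; _∧_; T)
open import Data.Bool.Properties using (T-∧)
open import Data.Empty using (⊥-elim)
open import Data.Fin.Base using (Fin; zero; suc; lift)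
open import Data.Fin.Patterns using (0F; 1F; 2F; 3F; 4F; 5F)
open import Data.List.Base as List using (List; []; _∷_; _++_; cartesianProductWith)
open import Data.List.Membership.Propositional using (_∈_)
open import Data.List.Membership.Propositional.Properties
  using (∈-map⁺; ∈-++⁺ˡ; ∈-++⁺ʳ; ∈-cartesianProductWith⁺)
import Data.List.Relation.Unary.All as ListAll
import Data.List.Relation.Unary.All.Properties as ListAll
open import Data.List.Relation.Unary.Any using (here; there)
open import Data.Nat.Base as ℕ using (ℕ; zero; suc; NonZero; _≡ᵇ_)
open import Data.Nat.DivMod using (_/_; _%_; m≡m%n+[m/n]*n; m%n<n)
open import Data.Nat.Divisibility
  using (_∣_; divides; quotient; m∣n⇒n≡quotient*m; m∣n⇒n≡m*quotient;
         m%n≡0⇒n∣m; ∣-trans; *-monoˡ-∣; m∣m*n; n∣m*n)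
open import Data.Nat.Induction using (<-rec)
open import Data.Nat.ListAction using (product)
open import Data.Nat.ListAction.Properties using (∈⇒∣product; product≢0)
import Data.Nat.Properties as ℕ
open import Data.Product.Base using (_×_; _,_; proj₁; proj₂; ∃-syntax; Σ-syntax)
open import Data.Product.Function.NonDependent.Propositional using (_×-⇔_)
open import Data.Sum.Base using (_⊎_; inj₁; inj₂)
open import Data.Sum.Function.Propositional using (_⊎-⇔_)
open import Data.Vec.Base using (Vec; []; _∷_; lookup; zipWith; map)
open import Data.Vec.Properties using (lookup-map)
open import Data.Vec.Relation.Binary.Pointwise.Inductive as Pointwise
  using (Pointwise; []; _∷_)
open import Data.Vec.Relation.Unary.All using (All; []; _∷_)
open import Function.Base using (_∘_; it)
open import Function.Bundles using (_⇔_; mk⇔; Equivalence)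
open import Function.Construct.Composition using (_⇔-∘_)
open import Function.Construct.Symmetry using (⇔-sym)
open import Function.Related.TypeIsomorphisms using (→-cong-⇔; ¬-cong-⇔)
open import Level using (Level)
import Relation.Binary.Construct.Add.Supremum.Equality as SupEquality
open import Relation.Binary.Construct.Add.Supremum.NonStrict using (_≤⊤⁺) renaming ([_] to ≤[_])
open import Relation.Binary.Construct.Add.Supremum.Strict using ([_]<⊤⁺) renaming ([_] to <[_])
open import Relation.Binary.Core using (Rel)
open import Relation.Binary.Definitions using (tri<; tri≈; tri>; _Respects₂_; Tri)
open import Relation.Binary.PropositionalEquality.Core as ≡ using (_≡_)
import Relation.Binary.Reasoning.Setoid as SetoidReasoning
open import Relation.Binary.Structures using (IsStrictTotalOrder; IsEquivalence)
open import Relation.Nullary.Construct.Add.Supremum using ([_])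
open import Relation.Nullary.Decidable.Core using (Dec; yes; no; decidable-stable)
open import Relation.Nullary.Negation.Core using (¬_)
open import Relation.Unary using (Pred; _⊂_; _⊆_)

open Equivalence using (to; from)

private
  variable
    ℓ : Level
    n : ℕ

-- Linear terms, multiples and convex subgroups in an ordered abelian group.

module OrderedGroupProperties {ℓ : Level} (G : OrderedAbelianGroup ℓ) where
  open OrderedAbelianGroup G public
  open IsStrictTotalOrder isStrictTotalOrder public
    using (compare; irrefl; asym; <-respˡ-≈; <-respʳ-≈)
    renaming (trans to <-trans)
  open AbelianGroupProperties abelianGroup public
    using (ε⁻¹≈ε; ⁻¹-∙-comm; xyx⁻¹≈y; ∙-cancelˡ; ∙-cancelʳ; x∙y⁻¹≈ε⇒x≈y)
  open Mult commutativeMonoid public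
    using (×-congʳ; ×-congˡ; ×-homo-+; ×-assocˡ; ×-distrib-+)
  open CommutativeSemigroupProperties commutativeSemigroup using (interchange)
  open SetoidReasoning setoid

  ⟦_⟧ : OgTerm n → Vec Carrier n → Carrier
  ⟦_⟧ = ⟦_⟧og G

  head⁺ head⁻ : OgTerm (suc n) → ℕ
  head⁺ (var zero)    = 1
  head⁺ (var (suc i)) = 0
  head⁺ (s ⊕ t)       = head⁺ s ℕ.+ head⁺ t
  head⁺ (⊖ t)         = head⁻ t
  head⁺ 𝟎             = 0
  head⁻ (var i)       = 0
  head⁻ (s ⊕ t)       = head⁻ s ℕ.+ head⁻ t
  head⁻ (⊖ t)         = head⁺ t
  head⁻ 𝟎             = 0

  tail : OgTerm (suc n) → OgTerm n
  tail (var zero)    = 𝟎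
  tail (var (suc i)) = var i
  tail (s ⊕ t)       = tail s ⊕ tail t
  tail (⊖ t)         = ⊖ tail t
  tail 𝟎             = 𝟎

  -- Moving the negative part of the leading coefficient to the left keeps all
  -- multiples natural.
  head-tail : (t : OgTerm (suc n)) → ∀ x ρ →
              ⟦ t ⟧ (x ∷ ρ) + head⁻ t · x ≈ head⁺ t · x + ⟦ tail t ⟧ ρ
  head-tail (var zero)    x ρ = sym (identityʳ _)
  head-tail (var (suc i)) x ρ = comm _ _
  head-tail (s ⊕ t)       x ρ = begin
    ⟦ s ⟧ (x ∷ ρ) + ⟦ t ⟧ (x ∷ ρ) + (head⁻ s ℕ.+ head⁻ t) · x
      ≈⟨ ∙-cong refl (×-homo-+ x (head⁻ s) (head⁻ t)) ⟩
    ⟦ s ⟧ (x ∷ ρ) + ⟦ t ⟧ (x ∷ ρ) + (head⁻ s · x + head⁻ t · x)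
      ≈⟨ interchange _ _ _ _ ⟩
    (⟦ s ⟧ (x ∷ ρ) + head⁻ s · x) + (⟦ t ⟧ (x ∷ ρ) + head⁻ t · x)
      ≈⟨ ∙-cong (head-tail s x ρ) (head-tail t x ρ) ⟩
    (head⁺ s · x + ⟦ tail s ⟧ ρ) + (head⁺ t · x + ⟦ tail t ⟧ ρ)
      ≈⟨ interchange _ _ _ _ ⟩
    (head⁺ s · x + head⁺ t · x) + (⟦ tail s ⟧ ρ + ⟦ tail t ⟧ ρ)
      ≈⟨ ∙-cong (×-homo-+ x (head⁺ s) (head⁺ t)) refl ⟨
    (head⁺ s ℕ.+ head⁺ t) · x + (⟦ tail s ⟧ ρ + ⟦ tail t ⟧ ρ) ∎
  head-tail (⊖ t) x ρ = begin
    - a + p                     ≈⟨ ∙-cong refl (identityʳ p) ⟨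
    - a + (p + 0#)              ≈⟨ ∙-cong refl (∙-cong refl (inverseʳ r)) ⟨
    - a + (p + (r + - r))       ≈⟨ ∙-cong refl (assoc p r (- r)) ⟨
    - a + (p + r + - r)         ≈⟨ ∙-cong refl (∙-cong (head-tail t x ρ) refl) ⟨
    - a + (a + q + - r)         ≈⟨ ∙-cong refl (assoc a q (- r)) ⟩
    - a + (a + (q + - r))       ≈⟨ assoc (- a) a (q + - r) ⟨
    - a + a + (q + - r)         ≈⟨ ∙-cong (inverseˡ a) refl ⟩
    0# + (q + - r)              ≈⟨ identityˡ _ ⟩
    q + - r                     ∎
    where
    a = ⟦ t ⟧ (x ∷ ρ)
    p = head⁺ t · x
    q = head⁻ t · x
    r = ⟦ tail t ⟧ ρ
  head-tail 𝟎             x ρ = refl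

  ⟦⟧-[] : (t : OgTerm 0) → ⟦ t ⟧ [] ≈ 0#
  ⟦⟧-[] (s ⊕ t) = trans (∙-cong (⟦⟧-[] s) (⟦⟧-[] t)) (identityˡ 0#)
  ⟦⟧-[] (⊖ t)   = trans (⁻¹-cong (⟦⟧-[] t)) ε⁻¹≈ε
  ⟦⟧-[] 𝟎       = refl

  vanishes : OgTerm n → Bool
  vanishes {zero}  t = true
  vanishes {suc n} t = (head⁺ t ≡ᵇ head⁻ t) ∧ vanishes (tail t)

  vanishes-sound : (t : OgTerm n) → T (vanishes t) → ∀ ρ → ⟦ t ⟧ ρ ≈ 0#
  vanishes-sound t _ []      = ⟦⟧-[] t
  vanishes-sound t v (x ∷ ρ) with h , v′ ← to T-∧ v = ∙-cancelʳ (head⁻ t · x) _ _ (begin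
    ⟦ t ⟧ (x ∷ ρ) + head⁻ t · x    ≈⟨ head-tail t x ρ ⟩
    head⁺ t · x + ⟦ tail t ⟧ ρ     ≈⟨ ∙-cong (×-congˡ (ℕ.≡ᵇ⇒≡ (head⁺ t) (head⁻ t) h))
                                             (vanishes-sound (tail t) v′ ρ) ⟩
    head⁻ t · x + 0#               ≈⟨ comm _ _ ⟩
    0# + head⁻ t · x               ∎)

  -- Proof by reflection: for concrete terms whose difference has only zero coefficients, the
  -- implicit argument reduces to the unit type and is filled in by eta.
  solve : (s t : OgTerm n) {_ : T (vanishes (s ⊕ (⊖ t)))} → ∀ ρ → ⟦ s ⟧ ρ ≈ ⟦ t ⟧ ρ
  solve s t {v} ρ = x∙y⁻¹≈ε⇒x≈y _ _ (vanishes-sound (s ⊕ (⊖ t)) v ρ)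

  ·-neg : ∀ k x → k · (- x) ≈ - (k · x)
  ·-neg zero    x = sym ε⁻¹≈ε
  ·-neg (suc k) x = trans (∙-cong refl (·-neg k x)) (⁻¹-∙-comm x (k · x))

  ·-0# : ∀ k → k · 0# ≈ 0#
  ·-0# zero    = refl
  ·-0# (suc k) = trans (identityˡ _) (·-0# k)

  ·-distrib-- : ∀ k x y → k · (x + - y) ≈ k · x + - (k · y)
  ·-distrib-- k x y = trans (×-distrib-+ x (- y) k) (∙-cong refl (·-neg k y))

  ·-comm : ∀ j k x → j · (k · x) ≈ k · (j · x)
  ·-comm j k x = begin
    j · (k · x)    ≈⟨ ×-assocˡ x j k ⟩
    (j ℕ.* k) · x  ≈⟨ ×-congˡ (ℕ.*-comm j k) ⟩
    (k ℕ.* j) · x  ≈⟨ ×-assocˡ x k j ⟨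
    k · (j · x)    ∎

  +-monoˡ-< : ∀ x {y z} → y < z → y + x < z + x
  +-monoˡ-< x y<z = <-respˡ-≈ (comm _ _) (<-respʳ-≈ (comm _ _) (+-monoʳ-< x y<z))

  +-mono-< : ∀ {w x y z} → w < x → y < z → w + y < x + z
  +-mono-< {x = x} {y} w<x y<z = <-trans (+-monoˡ-< y w<x) (+-monoʳ-< x y<z)

  neg-mono-< : ∀ {x y} → x < y → - y < - x
  neg-mono-< {x} {y} x<y =
    <-respˡ-≈ (solve (var 0F ⊕ ((⊖ var 0F) ⊕ (⊖ var 1F))) (⊖ var 1F) (x ∷ y ∷ []))
      (<-respʳ-≈ (solve (var 1F ⊕ ((⊖ var 0F) ⊕ (⊖ var 1F))) (⊖ var 0F) (x ∷ y ∷ []))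
        (+-monoˡ-< (- x + - y) x<y))

  x<y⇒0<y-x : ∀ {x y} → x < y → 0# < y + - x
  x<y⇒0<y-x {x} x<y = <-respˡ-≈ (inverseʳ x) (+-monoˡ-< (- x) x<y)

  ·-mono-< : ∀ k {x y} → x < y → suc k · x < suc k · y
  ·-mono-< zero    x<y = +-monoˡ-< 0# x<y
  ·-mono-< (suc k) x<y = +-mono-< x<y (·-mono-< k x<y)

  0<x⇒0<[1+k]x : ∀ k {x} → 0# < x → 0# < suc k · x
  0<x⇒0<[1+k]x k 0<x = <-respˡ-≈ (·-0# (suc k)) (·-mono-< k 0<x)

  0<x⇒x≤[1+k]x : ∀ k {x} → 0# < x → x ≤ suc k · x
  0<x⇒x≤[1+k]x zero        0<x = inj₂ (sym (identityʳ _))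
  0<x⇒x≤[1+k]x (suc k) {x} 0<x =
    inj₁ (<-respˡ-≈ (identityʳ x) (+-monoʳ-< x (0<x⇒0<[1+k]x k 0<x)))

  infixr 8 _⊙_
  _⊙_ : ℕ → OgTerm n → OgTerm n
  zero  ⊙ t = 𝟎
  suc k ⊙ t = t ⊕ (k ⊙ t)

  ⟦⊙⟧ : ∀ k (t : OgTerm n) ρ → ⟦ k ⊙ t ⟧ ρ ≈ k · ⟦ t ⟧ ρ
  ⟦⊙⟧ zero    t ρ = refl
  ⟦⊙⟧ (suc k) t ρ = ∙-cong refl (⟦⊙⟧ k t ρ)

  module ConvexSubgroup {H : Pred Carrier ℓ} (H-convexSubgroup : IsConvexSubgroup G H) where
    open IsConvexSubgroup H-convexSubgroup public

    -‿closed : ∀ {x y} → H x → H y → H (x + - y)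
    -‿closed x∈ y∈ = +-closed x∈ (neg-closed y∈)

    ·-closed : ∀ k {x} → H x → H (k · x)
    ·-closed zero    x∈ = 0∈
    ·-closed (suc k) x∈ = +-closed x∈ (·-closed k x∈)

    neg⁻-closed : ∀ {x} → H (- x) → H x
    neg⁻-closed {x} -x∈ = resp-≈ (solve (⊖ (⊖ var 0F)) (var 0F) (x ∷ [])) (neg-closed -x∈)

    convex-≤ : ∀ {x y z} → H x → H z → x < y → y ≤ z → H y
    convex-≤ x∈ z∈ x<y (inj₁ y<z) = convex x∈ z∈ x<y y<z
    convex-≤ x∈ z∈ x<y (inj₂ y≈z) = resp-≈ (sym y≈z) z∈

    -- A positive `x` lies between `0#` and `k · x`, so convexity applies; a negative one is
    -- replaced by `- x`. Hence the quotient by `H` is torsion-free.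
    ·⁻-closed : ∀ k .{{_ : NonZero k}} {x} → H (k · x) → H x
    ·⁻-closed (suc k) {x} kx∈ with compare 0# x
    ... | tri< 0<x _ _ = convex-≤ 0∈ kx∈ 0<x (0<x⇒x≤[1+k]x k 0<x)
    ... | tri≈ _ 0≈x _ = resp-≈ 0≈x 0∈
    ... | tri> _ _ x<0 = neg⁻-closed (convex-≤ 0∈ (resp-≈ (sym (·-neg (suc k) x)) (neg-closed kx∈))
                           0<-x (0<x⇒x≤[1+k]x k 0<-x))
      where 0<-x = <-respˡ-≈ ε⁻¹≈ε (neg-mono-< x<0)

  trivialConvexSubgroup : IsConvexSubgroup G (_≈ 0#)
  trivialConvexSubgroup = record
    { resp-≈     = λ x≈y x≈0 → trans (sym x≈y) x≈0
    ; 0∈         = refl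
    ; +-closed   = λ x≈0 y≈0 → trans (∙-cong x≈0 y≈0) (identityˡ 0#)
    ; neg-closed = λ x≈0 → trans (⁻¹-cong x≈0) ε⁻¹≈ε
    ; convex     = λ x≈0 z≈0 x<y y<z → ⊥-elim (irrefl (trans x≈0 (sym z≈0)) (<-trans x<y y<z))
    }

  -- Torsion-freeness of the group itself is `·⁻-closed` for the trivial convex subgroup.
  ·-cancel : ∀ k .{{_ : NonZero k}} {x y} → k · x ≈ k · y → x ≈ y
  ·-cancel k {x} {y} kx≈ky = x∙y⁻¹≈ε⇒x≈y x y
    (ConvexSubgroup.·⁻-closed trivialConvexSubgroup k
      (trans (·-distrib-- k x y) (trans (∙-cong kx≈ky refl) (inverseʳ _))))

  -- Makes the leading coefficient a natural number at the cost of a global sign, which is harmless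
  -- because membership in a subgroup and divisibility are invariant under negation.
  normalise : (t : OgTerm (suc n)) → ∃[ m ] Σ[ r ∈ OgTerm n ]
              ((∀ x ρ → ⟦ t ⟧ (x ∷ ρ) ≈ m · x + ⟦ r ⟧ ρ) ⊎
               (∀ x ρ → ⟦ t ⟧ (x ∷ ρ) ≈ - (m · x + ⟦ r ⟧ ρ)))
  normalise t with ℕ.≤-total (head⁻ t) (head⁺ t)
  ... | inj₁ q≤p with m , q+m≡p ← ℕ.m≤n⇒∃[o]m+o≡n q≤p =
    m , tail t , inj₁ λ x ρ → ∙-cancelʳ (head⁻ t · x) _ _ (begin
      ⟦ t ⟧ (x ∷ ρ) + head⁻ t · x             ≈⟨ head-tail t x ρ ⟩
      head⁺ t · x + ⟦ tail t ⟧ ρ              ≈⟨ ∙-cong (×-congˡ q+m≡p) refl ⟨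
      (head⁻ t ℕ.+ m) · x + ⟦ tail t ⟧ ρ      ≈⟨ ∙-cong (×-homo-+ x (head⁻ t) m) refl ⟩
      head⁻ t · x + m · x + ⟦ tail t ⟧ ρ
        ≈⟨ solve ((var 0F ⊕ var 1F) ⊕ var 2F) ((var 1F ⊕ var 2F) ⊕ var 0F)
                 (head⁻ t · x ∷ m · x ∷ ⟦ tail t ⟧ ρ ∷ []) ⟩
      m · x + ⟦ tail t ⟧ ρ + head⁻ t · x      ∎)
  ... | inj₂ p≤q with m , p+m≡q ← ℕ.m≤n⇒∃[o]m+o≡n p≤q =
    m , ⊖ tail t , inj₂ λ x ρ → ∙-cancelʳ (head⁻ t · x) _ _ (begin
      ⟦ t ⟧ (x ∷ ρ) + head⁻ t · x             ≈⟨ head-tail t x ρ ⟩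
      head⁺ t · x + ⟦ tail t ⟧ ρ
        ≈⟨ solve (var 0F ⊕ var 2F) ((⊖ (var 1F ⊕ (⊖ var 2F))) ⊕ (var 0F ⊕ var 1F))
                 (head⁺ t · x ∷ m · x ∷ ⟦ tail t ⟧ ρ ∷ []) ⟩
      - (m · x + - ⟦ tail t ⟧ ρ) + (head⁺ t · x + m · x)
        ≈⟨ ∙-cong refl (×-homo-+ x (head⁺ t) m) ⟨
      - (m · x + - ⟦ tail t ⟧ ρ) + (head⁺ t ℕ.+ m) · x
        ≈⟨ ∙-cong refl (×-congˡ p+m≡q) ⟩
      - (m · x + - ⟦ tail t ⟧ ρ) + head⁻ t · x ∎)

-- Split tuples as approximate complements of a convex subgroup.

least : ExcludedMiddle ℓ → (P : ℕ → Set ℓ) → ∀ k → P k →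
        ∃[ m ] (P m × (∀ {j} → j ℕ.< m → ¬ P j))
least {ℓ} em P = <-rec (λ k → P k → Least) step
  where
  Least : Set ℓ
  Least = ∃[ m ] (P m × (∀ {j} → j ℕ.< m → ¬ P j))

  step : ∀ k → (∀ {j} → j ℕ.< k → P j → Least) → P k → Least
  step k rec Pk with em {∃[ j ] (j ℕ.< k × P j)}
  ... | yes (j , j<k , Pj) = rec j<k Pj
  ... | no ¬smaller        = k , Pk , λ j<k Pj → ¬smaller (_ , j<k , Pj)

module Splitting {ℓ : Level} (em : ExcludedMiddle ℓ) (G : OrderedAbelianGroup ℓ)
  {D : Pred (OrderedAbelianGroup.Carrier G) ℓ} (D-convexSubgroup : IsConvexSubgroup G D) where

  open OrderedGroupProperties G
  open ConvexSubgroup D-convexSubgroup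
  open SetoidReasoning setoid

  -- An approximation, sufficient for formulas of bounded complexity, to "the
  -- entries of u generate a complement of D". A genuine complement need not
  -- exist.
  record Split (ts : List (OgTerm n)) (N : ℕ) (u : Vec Carrier n) : Set ℓ where
    field
      exact : ∀ {t} → t ∈ ts → D (⟦ t ⟧ u) → ⟦ t ⟧ u ≈ 0#
      pure  : ∀ t g → D (⟦ t ⟧ u + - (N · g)) → ∃[ h ] ⟦ t ⟧ u ≈ N · h

  open Split

  -- Multiplying the relation by the cofactor `q` of `M` in `N` gives one modulo `N` for the term
  -- `q ⊙ t`; torsion-freeness then cancels `q`.
  pure-∣ : ∀ {ts : List (OgTerm n)} {N u} {{_ : NonZero N}} → Split ts N u →
           ∀ {M} → M ∣ N → ∀ t g → D (⟦ t ⟧ u + - (M · g)) → ∃[ h ] ⟦ t ⟧ u ≈ M · h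
  pure-∣ {N = N} {u} split {M} (divides q N≡qM) t g t-Mg∈ =
    proj₁ q-div , ·-cancel q (begin
      q · ⟦ t ⟧ u              ≈⟨ ⟦⊙⟧ q t u ⟨
      ⟦ q ⊙ t ⟧ u              ≈⟨ proj₂ q-div ⟩
      N · proj₁ q-div          ≈⟨ N·≈ _ ⟩
      q · (M · proj₁ q-div)    ∎)
    where
    instance
      q≢0 : NonZero q
      q≢0 = ℕ.m*n≢0⇒m≢0 q {M} {{≡.subst NonZero N≡qM it}}

    N·≈ : ∀ x → N · x ≈ q · (M · x)
    N·≈ x = trans (×-congˡ N≡qM) (sym (×-assocˡ x q M))

    q-div : ∃[ h ] ⟦ q ⊙ t ⟧ u ≈ N · h
    q-div = pure split (q ⊙ t) g (resp-≈ (begin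
      q · (⟦ t ⟧ u + - (M · g))            ≈⟨ ·-distrib-- q _ _ ⟩
      q · ⟦ t ⟧ u + - (q · (M · g))        ≈⟨ ∙-cong (⟦⊙⟧ q t u) (⁻¹-cong (N·≈ g)) ⟨
      ⟦ q ⊙ t ⟧ u + - (N · g)              ∎) (·-closed q t-Mg∈))

  lead : OgTerm (suc n) → ℕ
  lead t = proj₁ (normalise t)

  rest : OgTerm (suc n) → OgTerm n
  rest t = proj₁ (proj₂ (normalise t))

  -- By `normalise`, both conditions need checking only on forms with a natural leading coefficient;
  -- the sign is absorbed by negating `g` and `h`.
  split-∷ : ∀ {ts : List (OgTerm (suc n))} {N w u} →
            (∀ {t} → t ∈ ts → D (lead t · w + ⟦ rest t ⟧ u) → lead t · w + ⟦ rest t ⟧ u ≈ 0#) →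
            (∀ m r g → D (m · w + ⟦ r ⟧ u + - (N · g)) → ∃[ h ] m · w + ⟦ r ⟧ u ≈ N · h) →
            Split ts N (w ∷ u)
  split-∷ {ts = ts} {N} {w} {u} e p = record { exact = λ {t} → exact′ t ; pure = pure′ }
    where
    exact′ : ∀ t → t ∈ ts → D (⟦ t ⟧ (w ∷ u)) → ⟦ t ⟧ (w ∷ u) ≈ 0#
    exact′ t t∈ t∈D with normalise t | e t∈
    ... | m , r , inj₁ t≈  | e′ = trans (t≈ w u) (e′ (resp-≈ (t≈ w u) t∈D))
    ... | m , r , inj₂ t≈- | e′ =
      trans (t≈- w u) (trans (⁻¹-cong (e′ (neg⁻-closed (resp-≈ (t≈- w u) t∈D)))) ε⁻¹≈ε)

    pure′ : ∀ t g → D (⟦ t ⟧ (w ∷ u) + - (N · g)) → ∃[ h ] ⟦ t ⟧ (w ∷ u) ≈ N · h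
    pure′ t g t-Ng∈ with normalise t
    ... | m , r , inj₁ t≈ with h , eq ← p m r g (resp-≈ (∙-cong (t≈ w u) refl) t-Ng∈) =
      h , trans (t≈ w u) eq
    ... | m , r , inj₂ t≈- with h , eq ← p m r (- g) (neg⁻-closed (resp-≈ (begin
            ⟦ t ⟧ (w ∷ u) + - (N · g)              ≈⟨ ∙-cong (t≈- w u) refl ⟩
            - (m · w + ⟦ r ⟧ u) + - (N · g)
              ≈⟨ solve ((⊖ var 0F) ⊕ (⊖ var 1F)) (⊖ (var 0F ⊕ (⊖ (⊖ var 1F))))
                       (m · w + ⟦ r ⟧ u ∷ N · g ∷ []) ⟩
            - (m · w + ⟦ r ⟧ u + - - (N · g))      ≈⟨ ⁻¹-cong (∙-cong refl (⁻¹-cong (·-neg N g))) ⟨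
            - (m · w + ⟦ r ⟧ u + - (N · (- g)))    ∎) t-Ng∈)) =
      - h , trans (t≈- w u) (trans (⁻¹-cong eq) (sym (·-neg N h)))

  -- The combination of the two normalised forms in which the leading variable cancels.
  eliminant : OgTerm (suc n) → OgTerm (suc n) → OgTerm n
  eliminant s t = (lead s ⊙ rest t) ⊕ (⊖ (lead t ⊙ rest s))

  module Extend (ts : List (OgTerm (suc n))) (N : ℕ) {{_ : NonZero N}} where

    -- A zero leading coefficient counts as 1, which keeps the product nonzero.
    leads : ℕ
    leads = product (List.map (λ t → 1 ℕ.⊔ lead t) ts)

    instance
      leads≢0 : NonZero leads
      leads≢0 = product≢0 (ListAll.map⁺ (ListAll.universal (1⊔≢0 ∘ lead) ts))
        where
        1⊔≢0 : ∀ m → NonZero (1 ℕ.⊔ m)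
        1⊔≢0 zero    = _
        1⊔≢0 (suc m) = _

      period≢0 : NonZero (leads ℕ.* N)
      period≢0 = ℕ.m*n≢0 leads N

    -- Purity of `u` is invoked modulo a leading coefficient, modulo such a coefficient times `N`,
    -- and modulo divisors of `N`; all of these divide this product.
    period : ℕ
    period = leads ℕ.* N

    lead∣leads : ∀ {t} → t ∈ ts → NonZero (lead t) → lead t ∣ leads
    lead∣leads {t} t∈ l≢0 = ≡.subst (_∣ leads) (1⊔≡ (lead t) l≢0)
      (∈⇒∣product (∈-map⁺ (λ t → 1 ℕ.⊔ lead t) t∈))
      where
      1⊔≡ : ∀ m → NonZero m → 1 ℕ.⊔ m ≡ m
      1⊔≡ (suc m) _ = ≡.refl

    -- The `rest` terms serve forms in which the new variable does not occur, the eliminants those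
    -- from which a relation removes it.
    terms : List (OgTerm n)
    terms = List.map rest ts ++ cartesianProductWith eliminant ts ts

    module _ {u : Vec Carrier n} (split : Split terms period u) (x : Carrier) where

      Extension : Set ℓ
      Extension = ∃[ w ] (D (x + - w) × Split ts N (w ∷ u))

      -- x is dependent on u modulo D: the complement determines w.
      dependent : ∀ {s} → s ∈ ts → NonZero (lead s) → D (lead s · x + ⟦ rest s ⟧ u) → Extension
      dependent {s} s∈ m≢0 sx∈ = w , x-w∈ , split-∷ {ts = ts} {N} exact′ pure′
        where
        instance
          lead-s≢0 : NonZero (lead s)
          lead-s≢0 = m≢0

        m = lead s
        r = rest s

        -- The relation makes `⟦ r ⟧ u` congruent to `m · (- x)` modulo `D`, so purity divides it by
        -- `m` exactly. With `w = - h` the relation holds at `w` on the nose.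
        division : ∃[ h ] ⟦ r ⟧ u ≈ m · h
        division = pure-∣ split (∣-trans (lead∣leads s∈ m≢0) (m∣m*n N)) r (- x) (resp-≈ (begin
          m · x + ⟦ r ⟧ u            ≈⟨ solve (var 0F ⊕ var 1F) (var 1F ⊕ (⊖ (⊖ var 0F)))
                                              (m · x ∷ ⟦ r ⟧ u ∷ []) ⟩
          ⟦ r ⟧ u + - - (m · x)      ≈⟨ ∙-cong refl (⁻¹-cong (·-neg m x)) ⟨
          ⟦ r ⟧ u + - (m · (- x))    ∎) sx∈)

        h = proj₁ division
        w = - h

        x-w∈ : D (x + - w)
        x-w∈ = ·⁻-closed m (resp-≈ (begin
          m · x + ⟦ r ⟧ u        ≈⟨ ∙-cong refl (proj₂ division) ⟩
          m · x + m · h          ≈⟨ ×-distrib-+ x h m ⟨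
          m · (x + h)            ≈⟨ ×-congʳ m (solve (var 0F ⊕ var 1F) (var 0F ⊕ (⊖ (⊖ var 1F)))
                                                     (x ∷ h ∷ [])) ⟩
          m · (x + - w)          ∎) sx∈)

        -- As `m · w` equals `- ⟦ r ⟧ u`, a form involving `w` becomes, after multiplication by `m`,
        -- a form in `u` alone.
        eliminate : ∀ k q → m · (k · w + ⟦ q ⟧ u) ≈ ⟦ (m ⊙ q) ⊕ (⊖ (k ⊙ r)) ⟧ u
        eliminate k q = begin
          m · (k · w + ⟦ q ⟧ u)              ≈⟨ ×-distrib-+ _ _ m ⟩
          m · (k · w) + m · ⟦ q ⟧ u          ≈⟨ ∙-cong (·-comm m k w) refl ⟩
          k · (m · w) + m · ⟦ q ⟧ u          ≈⟨ ∙-cong (×-congʳ k (·-neg m h)) refl ⟩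
          k · (- (m · h)) + m · ⟦ q ⟧ u      ≈⟨ ∙-cong (·-neg k (m · h)) refl ⟩
          - (k · (m · h)) + m · ⟦ q ⟧ u
            ≈⟨ ∙-cong (⁻¹-cong (×-congʳ k (proj₂ division))) refl ⟨
          - (k · ⟦ r ⟧ u) + m · ⟦ q ⟧ u      ≈⟨ comm _ _ ⟩
          m · ⟦ q ⟧ u + - (k · ⟦ r ⟧ u)
            ≈⟨ ∙-cong (⟦⊙⟧ m q u) (⁻¹-cong (⟦⊙⟧ k r u)) ⟨
          ⟦ (m ⊙ q) ⊕ (⊖ (k ⊙ r)) ⟧ u        ∎

        exact′ : ∀ {t} → t ∈ ts → D (lead t · w + ⟦ rest t ⟧ u) → lead t · w + ⟦ rest t ⟧ u ≈ 0#
        exact′ {t} t∈ tw∈ = ·-cancel m (begin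
          m · (lead t · w + ⟦ rest t ⟧ u)    ≈⟨ eliminate (lead t) (rest t) ⟩
          ⟦ eliminant s t ⟧ u
            ≈⟨ exact split (∈-++⁺ʳ (List.map rest ts) (∈-cartesianProductWith⁺ eliminant s∈ t∈))
                     (resp-≈ (eliminate (lead t) (rest t)) (·-closed m tw∈)) ⟩
          0#                                 ≈⟨ ·-0# m ⟨
          m · 0#                             ∎)

        pure′ : ∀ k q g → D (k · w + ⟦ q ⟧ u + - (N · g)) → ∃[ h′ ] k · w + ⟦ q ⟧ u ≈ N · h′
        pure′ k q g kw+q-Ng∈ = proj₁ divided , ·-cancel m (begin
          m · (k · w + ⟦ q ⟧ u)              ≈⟨ eliminate k q ⟩
          ⟦ (m ⊙ q) ⊕ (⊖ (k ⊙ r)) ⟧ u        ≈⟨ proj₂ divided ⟩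
          (m ℕ.* N) · proj₁ divided          ≈⟨ ×-assocˡ _ m N ⟨
          m · (N · proj₁ divided)            ∎)
          where
          -- Multiplying by `m` raises the modulus to `m ℕ.* N`, which still divides the period
          -- since `m` divides `leads`.
          divided : ∃[ h ] ⟦ (m ⊙ q) ⊕ (⊖ (k ⊙ r)) ⟧ u ≈ (m ℕ.* N) · h
          divided = pure-∣ split (*-monoˡ-∣ N (lead∣leads s∈ m≢0)) ((m ⊙ q) ⊕ (⊖ (k ⊙ r))) g
            (resp-≈ (begin
              m · (k · w + ⟦ q ⟧ u + - (N · g))
                ≈⟨ ·-distrib-- m _ _ ⟩
              m · (k · w + ⟦ q ⟧ u) + - (m · (N · g))
                ≈⟨ ∙-cong (eliminate k q) (⁻¹-cong (×-assocˡ g m N)) ⟩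
              ⟦ (m ⊙ q) ⊕ (⊖ (k ⊙ r)) ⟧ u + - ((m ℕ.* N) · g)  ∎) (·-closed m kw+q-Ng∈))

      Occurs : ℕ → Set ℓ
      Occurs m = NonZero m × ∃[ r ] ∃[ g ] D (m · x + ⟦ r ⟧ u + - (N · g))

      -- Shows that `N` itself occurs as a coefficient: the search for the least one can start
      -- there, and that least one divides `N`.
      N-relation : D (N · x + 0# + - (N · x))
      N-relation = resp-≈ (sym (trans (∙-cong (identityʳ _) refl) (inverseʳ _))) 0∈

      -- The coefficients of x in relations modulo D and N are the multiples of
      -- m₀, and a single congruence determines w.
      independent : (∀ {t} → t ∈ ts → NonZero (lead t) → ¬ D (lead t · x + ⟦ rest t ⟧ u)) →
                    ∀ m₀ → {{_ : NonZero m₀}} → ∀ r₀ g₀ → D (m₀ · x + ⟦ r₀ ⟧ u + - (N · g₀)) →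
                    (∀ {j} → j ℕ.< m₀ → ¬ Occurs j) → Extension
      independent indep m₀ r₀ g₀ rel₀ minimal = w , x-w∈ , split-∷ {ts = ts} {N} exact′ pure′
        where
        -- Subtracting `q` times the minimal relation leaves a relation of the same kind with
        -- leading part `j`, as in a division with remainder.
        reduce : ∀ j q y r g a → y ≈ j + q · a →
                 y + ⟦ r ⟧ u + - (N · g) + - (q · (a + ⟦ r₀ ⟧ u + - (N · g₀))) ≈
                 j + ⟦ r ⊕ (⊖ (q ⊙ r₀)) ⟧ u + - (N · (g + - (q · g₀)))
        reduce j q y r g a y≈ = begin
          y + ⟦ r ⟧ u + - (N · g) + - (q · (a + ⟦ r₀ ⟧ u + - (N · g₀)))
            ≈⟨ ∙-cong (∙-cong (∙-cong y≈ refl) refl) (⁻¹-cong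
                 (trans (·-distrib-- q _ _) (∙-cong (×-distrib-+ _ _ q) (⁻¹-cong (·-comm q N g₀))))) ⟩
          j + q · a + ⟦ r ⟧ u + - (N · g) + - (q · a + q · ⟦ r₀ ⟧ u + - (N · (q · g₀)))
            ≈⟨ solve ((((var 0F ⊕ var 1F) ⊕ var 2F) ⊕ (⊖ var 3F)) ⊕
                      (⊖ ((var 1F ⊕ var 4F) ⊕ (⊖ var 5F))))
                     ((var 0F ⊕ (var 2F ⊕ (⊖ var 4F))) ⊕ (⊖ (var 3F ⊕ (⊖ var 5F))))
                     (j ∷ q · a ∷ ⟦ r ⟧ u ∷ N · g ∷ q · ⟦ r₀ ⟧ u ∷ N · (q · g₀) ∷ []) ⟩
          j + (⟦ r ⟧ u + - (q · ⟦ r₀ ⟧ u)) + - (N · g + - (N · (q · g₀)))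
            ≈⟨ ∙-cong (∙-cong refl (∙-cong refl (⁻¹-cong (⟦⊙⟧ q r₀ u)))) (⁻¹-cong (·-distrib-- N _ _)) ⟨
          j + ⟦ r ⊕ (⊖ (q ⊙ r₀)) ⟧ u + - (N · (g + - (q · g₀))) ∎

        -- A nonzero remainder of `m` modulo `m₀` would itself occur as a coefficient, against
        -- minimality.
        m₀∣ : ∀ m r g → D (m · x + ⟦ r ⟧ u + - (N · g)) → m₀ ∣ m
        m₀∣ m r g rel with m % m₀ in m%m₀≡
        ... | zero  = m%n≡0⇒n∣m m m₀ m%m₀≡
        ... | suc k = ⊥-elim (minimal (≡.subst (ℕ._< m₀) m%m₀≡ (m%n<n m m₀))
          (_ , r ⊕ (⊖ ((m / m₀) ⊙ r₀)) , g + - ((m / m₀) · g₀) , resp-≈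
            (reduce (suc k · x) (m / m₀) (m · x) r g (m₀ · x) (begin
              m · x                                    ≈⟨ ×-congˡ (m≡m%n+[m/n]*n m m₀) ⟩
              (m % m₀ ℕ.+ m / m₀ ℕ.* m₀) · x           ≈⟨ ×-homo-+ x (m % m₀) (m / m₀ ℕ.* m₀) ⟩
              (m % m₀) · x + (m / m₀ ℕ.* m₀) · x       ≈⟨ ∙-cong (×-congˡ m%m₀≡) (sym (×-assocˡ x (m / m₀) m₀)) ⟩
              suc k · x + (m / m₀) · (m₀ · x)            ∎))
            (-‿closed rel (·-closed (m / m₀) rel₀))))

        m₀∣N : m₀ ∣ N
        m₀∣N = m₀∣ N 𝟎 x N-relation

        c = quotient m₀∣N

        N·≈ : ∀ g → N · g ≈ m₀ · (c · g)
        N·≈ g = trans (×-congˡ (m∣n⇒n≡m*quotient m₀∣N)) (sym (×-assocˡ g m₀ c))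

        division : ∃[ h ] ⟦ r₀ ⟧ u ≈ m₀ · h
        division = pure-∣ split (∣-trans m₀∣N (n∣m*n leads)) r₀ (c · g₀ + - x) (resp-≈ (begin
          m₀ · x + ⟦ r₀ ⟧ u + - (N · g₀)
            ≈⟨ solve ((var 0F ⊕ var 1F) ⊕ (⊖ var 2F)) (var 1F ⊕ (⊖ (var 2F ⊕ (⊖ var 0F))))
                     (m₀ · x ∷ ⟦ r₀ ⟧ u ∷ N · g₀ ∷ []) ⟩
          ⟦ r₀ ⟧ u + - (N · g₀ + - (m₀ · x))
            ≈⟨ ∙-cong refl (⁻¹-cong (∙-cong (N·≈ g₀) refl)) ⟩
          ⟦ r₀ ⟧ u + - (m₀ · (c · g₀) + - (m₀ · x))
            ≈⟨ ∙-cong refl (⁻¹-cong (·-distrib-- m₀ _ _)) ⟨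
          ⟦ r₀ ⟧ u + - (m₀ · (c · g₀ + - x))  ∎) rel₀)

        -- Chosen so that `m₀ · w + ⟦ r₀ ⟧ u` equals `N · g₀` exactly, where `x` satisfies this only
        -- modulo `D`.
        w = c · g₀ + - proj₁ division

        m₀·w : m₀ · w ≈ N · g₀ + - ⟦ r₀ ⟧ u
        m₀·w = begin
          m₀ · w                                       ≈⟨ ·-distrib-- m₀ _ _ ⟩
          m₀ · (c · g₀) + - (m₀ · proj₁ division)      ≈⟨ ∙-cong (N·≈ g₀) (⁻¹-cong (proj₂ division)) ⟨
          N · g₀ + - ⟦ r₀ ⟧ u                          ∎

        x-w∈ : D (x + - w)
        x-w∈ = ·⁻-closed m₀ (resp-≈ (begin
          m₀ · x + ⟦ r₀ ⟧ u + - (N · g₀)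
            ≈⟨ solve ((var 0F ⊕ var 1F) ⊕ (⊖ var 2F)) (var 0F ⊕ (⊖ (var 2F ⊕ (⊖ var 1F))))
                     (m₀ · x ∷ ⟦ r₀ ⟧ u ∷ N · g₀ ∷ []) ⟩
          m₀ · x + - (N · g₀ + - ⟦ r₀ ⟧ u)    ≈⟨ ∙-cong refl (⁻¹-cong m₀·w) ⟨
          m₀ · x + - (m₀ · w)                 ≈⟨ ·-distrib-- m₀ x w ⟨
          m₀ · (x + - w)                      ∎) rel₀)

        w⇒x : ∀ m y → D (m · w + y) → D (m · x + y)
        w⇒x m y mw+y∈ = resp-≈ (begin
          m · w + y + m · (x + - w)
            ≈⟨ ∙-cong refl (·-distrib-- m x w) ⟩
          m · w + y + (m · x + - (m · w))
            ≈⟨ solve ((var 0F ⊕ var 1F) ⊕ (var 2F ⊕ (⊖ var 0F))) (var 2F ⊕ var 1F)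
                     (m · w ∷ y ∷ m · x ∷ []) ⟩
          m · x + y ∎) (+-closed mw+y∈ (·-closed m x-w∈))

        exact′ : ∀ {t} → t ∈ ts → D (lead t · w + ⟦ rest t ⟧ u) → lead t · w + ⟦ rest t ⟧ u ≈ 0#
        exact′ {t} t∈ tw∈ with lead t in lead≡ | indep t∈
        -- Without `w` the form is covered by `terms`; with `w`, its membership in `D` would carry
        -- over to `x` and contradict independence.
        ... | zero  | _ = trans (identityˡ _)
          (exact split (∈-++⁺ˡ (∈-map⁺ rest t∈)) (resp-≈ (identityˡ _) tw∈))
        ... | suc k | indep′ = ⊥-elim (indep′ _ (w⇒x (suc k) _ tw∈))

        -- Replacing `m₀ · w` by `N · g₀ + - ⟦ r₀ ⟧ u` turns the relation into one modulo `N` in `u`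
        -- alone, to which purity of `u` applies.
        multiple : ∀ q r g y → y ≈ q · (m₀ · w) → D (y + ⟦ r ⟧ u + - (N · g)) →
                   ∃[ h ] y + ⟦ r ⟧ u ≈ N · h
        multiple q r g y y≈ rel = proj₁ divided + q · g₀ , (begin
          y + ⟦ r ⟧ u
            ≈⟨ ∙-cong y≈′ refl ⟩
          q · (N · g₀) + - (q · ⟦ r₀ ⟧ u) + ⟦ r ⟧ u
            ≈⟨ solve ((var 0F ⊕ (⊖ var 1F)) ⊕ var 2F) ((var 2F ⊕ (⊖ var 1F)) ⊕ var 0F)
                     (q · (N · g₀) ∷ q · ⟦ r₀ ⟧ u ∷ ⟦ r ⟧ u ∷ []) ⟩
          ⟦ r ⟧ u + - (q · ⟦ r₀ ⟧ u) + q · (N · g₀)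
            ≈⟨ ∙-cong (∙-cong refl (⁻¹-cong (⟦⊙⟧ q r₀ u))) (·-comm N q g₀) ⟨
          ⟦ r ⊕ (⊖ (q ⊙ r₀)) ⟧ u + N · (q · g₀)
            ≈⟨ ∙-cong (proj₂ divided) refl ⟩
          N · proj₁ divided + N · (q · g₀)
            ≈⟨ ×-distrib-+ _ _ N ⟨
          N · (proj₁ divided + q · g₀) ∎)
          where
          y≈′ : y ≈ q · (N · g₀) + - (q · ⟦ r₀ ⟧ u)
          y≈′ = begin
            y                                      ≈⟨ y≈ ⟩
            q · (m₀ · w)                           ≈⟨ ×-congʳ q m₀·w ⟩
            q · (N · g₀ + - ⟦ r₀ ⟧ u)              ≈⟨ ·-distrib-- q _ _ ⟩
            q · (N · g₀) + - (q · ⟦ r₀ ⟧ u)        ∎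

          divided : ∃[ h ] ⟦ r ⊕ (⊖ (q ⊙ r₀)) ⟧ u ≈ N · h
          divided = pure-∣ split (n∣m*n leads) (r ⊕ (⊖ (q ⊙ r₀))) (g + - (q · g₀)) (resp-≈ (begin
            y + ⟦ r ⟧ u + - (N · g)
              ≈⟨ ∙-cong (∙-cong y≈′ refl) refl ⟩
            q · (N · g₀) + - (q · ⟦ r₀ ⟧ u) + ⟦ r ⟧ u + - (N · g)
              ≈⟨ ∙-cong (∙-cong (∙-cong (·-comm q N g₀) refl) refl) refl ⟩
            N · (q · g₀) + - (q · ⟦ r₀ ⟧ u) + ⟦ r ⟧ u + - (N · g)
              ≈⟨ solve (((var 0F ⊕ (⊖ var 1F)) ⊕ var 2F) ⊕ (⊖ var 3F))
                       ((var 2F ⊕ (⊖ var 1F)) ⊕ (⊖ (var 3F ⊕ (⊖ var 0F))))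
                       (N · (q · g₀) ∷ q · ⟦ r₀ ⟧ u ∷ ⟦ r ⟧ u ∷ N · g ∷ []) ⟩
            ⟦ r ⟧ u + - (q · ⟦ r₀ ⟧ u) + - (N · g + - (N · (q · g₀)))
              ≈⟨ ∙-cong (∙-cong refl (⁻¹-cong (⟦⊙⟧ q r₀ u))) (⁻¹-cong (·-distrib-- N _ _)) ⟨
            ⟦ r ⊕ (⊖ (q ⊙ r₀)) ⟧ u + - (N · (g + - (q · g₀))) ∎) rel)

        pure′ : ∀ m r g → D (m · w + ⟦ r ⟧ u + - (N · g)) → ∃[ h ] m · w + ⟦ r ⟧ u ≈ N · h
        pure′ m r g rel = multiple (quotient m₀∣m) r g (m · w)
          (trans (×-congˡ (m∣n⇒n≡quotient*m m₀∣m)) (sym (×-assocˡ w (quotient m₀∣m) m₀))) rel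
          where
          m₀∣m : m₀ ∣ m
          m₀∣m = m₀∣ m r g (resp-≈ (sym (assoc _ _ _)) (w⇒x m _ (resp-≈ (assoc _ _ _) rel)))

      -- If a listed form with nonzero leading coefficient puts `x` in relation with `u` modulo `D`,
      -- that relation dictates `w`. Otherwise exactness is no constraint on the new coordinate, and
      -- `w` is chosen for purity.
      extend : Extension
      extend with em {∃[ t ] (t ∈ ts × NonZero (lead t) × D (lead t · x + ⟦ rest t ⟧ u))}
      ... | yes (t , t∈ , l≢0 , rel) = dependent t∈ l≢0 rel
      ... | no ¬dep =
        let m₀ , (m₀≢0 , r₀ , g₀ , rel₀) , minimal = least em Occurs N (it , 𝟎 , x , N-relation)
        in independent (λ t∈ l≢0 rel → ¬dep (_ , t∈ , l≢0 , rel)) m₀ {{m₀≢0}} r₀ g₀ rel₀ minimal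

  split-[] : ∀ {ts : List (OgTerm 0)} {N} → Split ts N []
  split-[] {N = N} = record
    { exact = λ {t} _ _ → ⟦⟧-[] t
    ; pure  = λ t _ _ → 0# , trans (⟦⟧-[] t) (sym (·-0# N))
    }

-- Invariance of satisfaction under equality, and the quotient by a convex subgroup.

module SemanticsProperties {ℓ : Level} {A : Set ℓ} {_≈_ _<_ : Rel A ℓ}
  (≈-isEquivalence : IsEquivalence _≈_) (<-resp-≈ : _<_ Respects₂ _≈_)
  {T : ℕ → Set} (⟦_⟧ : ∀ {n} → T n → Vec A n → A)
  (⟦⟧-cong : ∀ {n} (t : T n) {ρ ρ′} → Pointwise _≈_ ρ ρ′ → ⟦ t ⟧ ρ ≈ ⟦ t ⟧ ρ′)
  where

  open IsEquivalence ≈-isEquivalence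
  open Semantics _≈_ _<_ ⟦_⟧

  ⊨-cong : (φ : Formula T n) → ∀ {ρ ρ′} → Pointwise _≈_ ρ ρ′ → ρ ⊨ φ → ρ′ ⊨ φ
  ⊨-cong (s ≐ t) eq p        = trans (sym (⟦⟧-cong s eq)) (trans p (⟦⟧-cong t eq))
  ⊨-cong (s ≺ t) eq p        = proj₂ <-resp-≈ (⟦⟧-cong s eq) (proj₁ <-resp-≈ (⟦⟧-cong t eq) p)
  ⊨-cong (¬̇ φ)   eq p q      = p (⊨-cong φ (Pointwise.sym sym eq) q)
  ⊨-cong (φ ∧̇ ψ) eq (p , q)  = ⊨-cong φ eq p , ⊨-cong ψ eq q
  ⊨-cong (φ ∨̇ ψ) eq (inj₁ p) = inj₁ (⊨-cong φ eq p)
  ⊨-cong (φ ∨̇ ψ) eq (inj₂ q) = inj₂ (⊨-cong ψ eq q)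
  ⊨-cong (φ ⇒̇ ψ) eq p q      = ⊨-cong ψ eq (p (⊨-cong φ (Pointwise.sym sym eq) q))
  ⊨-cong (∀̇ φ)   eq p a      = ⊨-cong φ (refl ∷ eq) (p a)
  ⊨-cong (∃̇ φ)   eq (a , p)  = a , ⊨-cong φ (refl ∷ eq) p

module Quotient {ℓ : Level} (G : OrderedAbelianGroup ℓ)
  {D : Pred (OrderedAbelianGroup.Carrier G) ℓ} (D-convexSubgroup : IsConvexSubgroup G D) where

  open OrderedGroupProperties G
  open ConvexSubgroup D-convexSubgroup

  -- G / D is the carrier of G with a coarser equality.
  infix 4 _≈ᴰ_ _<ᴰ_

  _≈ᴰ_ _<ᴰ_ : Rel Carrier ℓ
  x ≈ᴰ y = D (x + - y)
  x <ᴰ y = x < y × ¬ (x ≈ᴰ y)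

  open Semantics _≈_ _<_ ⟦_⟧ public using (_⊨_)
  open Semantics _≈ᴰ_ _<ᴰ_ ⟦_⟧ public renaming (_⊨_ to _⊨ᴰ_; Definable to Definableᴰ)

  ≈⇒≈ᴰ : ∀ {x y} → x ≈ y → x ≈ᴰ y
  ≈⇒≈ᴰ {y = y} x≈y = resp-≈ (sym (trans (∙-cong x≈y refl) (inverseʳ y))) 0∈

  ≈ᴰ-sym : ∀ {x y} → x ≈ᴰ y → y ≈ᴰ x
  ≈ᴰ-sym {x} {y} x≈y =
    resp-≈ (solve (⊖ (var 0F ⊕ (⊖ var 1F))) (var 1F ⊕ (⊖ var 0F)) (x ∷ y ∷ [])) (neg-closed x≈y)

  ≈ᴰ-trans : ∀ {x y z} → x ≈ᴰ y → y ≈ᴰ z → x ≈ᴰ z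
  ≈ᴰ-trans {x} {y} {z} x≈y y≈z =
    resp-≈ (solve ((var 0F ⊕ (⊖ var 1F)) ⊕ (var 1F ⊕ (⊖ var 2F))) (var 0F ⊕ (⊖ var 2F))
                  (x ∷ y ∷ z ∷ [])) (+-closed x≈y y≈z)

  ≈ᴰ-isEquivalence : IsEquivalence _≈ᴰ_
  ≈ᴰ-isEquivalence = record { refl = ≈⇒≈ᴰ refl ; sym = ≈ᴰ-sym ; trans = ≈ᴰ-trans }

  -- If `z < y`, then `z + - x` would lie between `0#` and `y + - x`, hence in `D` by convexity.
  <ᴰ-respˡ : ∀ {x y z} → x ≈ᴰ y → x <ᴰ z → y <ᴰ z
  <ᴰ-respˡ {x} {y} {z} x≈y (x<z , x≉z) = y<z , y≉z
    where
    y≉z : ¬ (y ≈ᴰ z)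
    y≉z y≈z = x≉z (≈ᴰ-trans x≈y y≈z)

    y<z : y < z
    y<z with compare y z
    ... | tri< y<z _ _ = y<z
    ... | tri≈ _ y≈z _ = ⊥-elim (y≉z (≈⇒≈ᴰ y≈z))
    ... | tri> _ _ z<y = ⊥-elim (x≉z (≈ᴰ-sym
      (convex 0∈ (≈ᴰ-sym x≈y) (x<y⇒0<y-x x<z) (+-monoˡ-< (- x) z<y))))

  <ᴰ-respʳ : ∀ {x y z} → x ≈ᴰ y → z <ᴰ x → z <ᴰ y
  <ᴰ-respʳ {x} {y} {z} x≈y (z<x , z≉x) = z<y , z≉y
    where
    z≉y : ¬ (z ≈ᴰ y)
    z≉y z≈y = z≉x (≈ᴰ-trans z≈y (≈ᴰ-sym x≈y))

    z<y : z < y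
    z<y with compare z y
    ... | tri< z<y _ _ = z<y
    ... | tri≈ _ z≈y _ = ⊥-elim (z≉y (≈⇒≈ᴰ z≈y))
    ... | tri> _ _ y<z = ⊥-elim (z≉y
      (convex 0∈ x≈y (x<y⇒0<y-x y<z) (+-monoˡ-< (- y) z<x)))

  <ᴰ-resp-≈ᴰ : _<ᴰ_ Respects₂ _≈ᴰ_
  <ᴰ-resp-≈ᴰ = <ᴰ-respʳ , <ᴰ-respˡ

  ⟦⟧-cong : (t : OgTerm n) → ∀ {ρ ρ′} → Pointwise _≈_ ρ ρ′ → ⟦ t ⟧ ρ ≈ ⟦ t ⟧ ρ′
  ⟦⟧-cong (var i) eq = Pointwise.lookup eq i
  ⟦⟧-cong (s ⊕ t) eq = ∙-cong (⟦⟧-cong s eq) (⟦⟧-cong t eq)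
  ⟦⟧-cong (⊖ t)   eq = ⁻¹-cong (⟦⟧-cong t eq)
  ⟦⟧-cong 𝟎       eq = refl

  ⟦⟧-congᴰ : (t : OgTerm n) → ∀ {ρ ρ′} → Pointwise _≈ᴰ_ ρ ρ′ → ⟦ t ⟧ ρ ≈ᴰ ⟦ t ⟧ ρ′
  ⟦⟧-congᴰ (var i) eq = Pointwise.lookup eq i
  ⟦⟧-congᴰ (s ⊕ t) {ρ} {ρ′} eq =
    resp-≈ (solve ((var 0F ⊕ (⊖ var 1F)) ⊕ (var 2F ⊕ (⊖ var 3F)))
                  ((var 0F ⊕ var 2F) ⊕ (⊖ (var 1F ⊕ var 3F)))
                  (⟦ s ⟧ ρ ∷ ⟦ s ⟧ ρ′ ∷ ⟦ t ⟧ ρ ∷ ⟦ t ⟧ ρ′ ∷ []))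
           (+-closed (⟦⟧-congᴰ s eq) (⟦⟧-congᴰ t eq))
  ⟦⟧-congᴰ (⊖ t) {ρ} {ρ′} eq =
    resp-≈ (solve (⊖ (var 0F ⊕ (⊖ var 1F))) ((⊖ var 0F) ⊕ (⊖ (⊖ var 1F)))
                  (⟦ t ⟧ ρ ∷ ⟦ t ⟧ ρ′ ∷ []))
           (neg-closed (⟦⟧-congᴰ t eq))
  ⟦⟧-congᴰ 𝟎       eq = ≈⇒≈ᴰ refl

  open SemanticsProperties isEquivalence
    (IsStrictTotalOrder.<-resp-≈ isStrictTotalOrder) ⟦_⟧ ⟦⟧-cong public using (⊨-cong)
  open SemanticsProperties ≈ᴰ-isEquivalence <ᴰ-resp-≈ᴰ ⟦_⟧ ⟦⟧-congᴰ public
    renaming (⊨-cong to ⊨ᴰ-cong)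

  ⟦⟧-homo-+ : (t : OgTerm n) → ∀ ρ ρ′ → ⟦ t ⟧ (zipWith _+_ ρ ρ′) ≈ ⟦ t ⟧ ρ + ⟦ t ⟧ ρ′
  ⟦⟧-homo-+ (var zero)    (x ∷ ρ) (y ∷ ρ′) = refl
  ⟦⟧-homo-+ (var (suc i)) (x ∷ ρ) (y ∷ ρ′) = ⟦⟧-homo-+ (var i) ρ ρ′
  ⟦⟧-homo-+ (s ⊕ t) ρ ρ′ =
    trans (∙-cong (⟦⟧-homo-+ s ρ ρ′) (⟦⟧-homo-+ t ρ ρ′))
      (solve ((var 0F ⊕ var 1F) ⊕ (var 2F ⊕ var 3F)) ((var 0F ⊕ var 2F) ⊕ (var 1F ⊕ var 3F))
             (⟦ s ⟧ ρ ∷ ⟦ s ⟧ ρ′ ∷ ⟦ t ⟧ ρ ∷ ⟦ t ⟧ ρ′ ∷ []))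
  ⟦⟧-homo-+ (⊖ t) ρ ρ′ = trans (⁻¹-cong (⟦⟧-homo-+ t ρ ρ′)) (sym (⁻¹-∙-comm _ _))
  ⟦⟧-homo-+ 𝟎     ρ ρ′ = sym (identityˡ 0#)

  ⟦⟧-closed : (t : OgTerm n) → ∀ {ρ} → All D ρ → D (⟦ t ⟧ ρ)
  ⟦⟧-closed (var zero)    (x∈ ∷ ρ∈) = x∈
  ⟦⟧-closed (var (suc i)) (x∈ ∷ ρ∈) = ⟦⟧-closed (var i) ρ∈
  ⟦⟧-closed (s ⊕ t)       ρ∈ = +-closed (⟦⟧-closed s ρ∈) (⟦⟧-closed t ρ∈)
  ⟦⟧-closed (⊖ t)         ρ∈ = neg-closed (⟦⟧-closed t ρ∈)
  ⟦⟧-closed 𝟎             ρ∈ = 0∈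

  x+d≈ᴰx : ∀ {x d} → D d → x + d ≈ᴰ x
  x+d≈ᴰx {x} {d} d∈ = resp-≈ (sym (xyx⁻¹≈y x d)) d∈

-- Feferman-Vaught transfer of definability from `G` to `G / D`.

module Transfer {ℓ : Level} (em : ExcludedMiddle ℓ) (G : OrderedAbelianGroup ℓ)
  {D : Pred (OrderedAbelianGroup.Carrier G) ℓ} (D-convexSubgroup : IsConvexSubgroup G D) where

  open OrderedGroupProperties G
  open ConvexSubgroup D-convexSubgroup
  open Quotient G D-convexSubgroup
  open Splitting em G D-convexSubgroup
  open Split

  split-weaken : ∀ {ts us : List (OgTerm n)} {M N} {{_ : NonZero N}} {u} →
                 (∀ {t} → t ∈ us → t ∈ ts) → M ∣ N → Split ts N u → Split us M u
  split-weaken us⊆ts M∣N split = record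
    { exact = exact split ∘ us⊆ts
    ; pure  = pure-∣ split M∣N
    }

  -- Every point of G is u + d with u taken from a split tuple and d from D.
  -- On such points P is a property of u modulo D, chosen by d from finitely
  -- many.
  record Transfers {n} (P : Pred (Vec Carrier n) ℓ) : Set ℓ where
    field
      terms         : List (OgTerm n)
      period        : ℕ
      {{period≢0}}  : NonZero period
      formulas      : List (Formula OgTerm n)

    Represents : Formula OgTerm n → Vec Carrier n → Set ℓ
    Represents ψ d = ∀ u → Split terms period u → P (zipWith _+_ u d) ⇔ (u ⊨ᴰ ψ)

    field
      represent : ∀ {d} → All D d → ∃[ ψ ] (ψ ∈ formulas × Represents ψ d)

  open Transfers

  transfers-⇔ : {P Q : Pred (Vec Carrier n) ℓ} → (∀ ρ → P ρ ⇔ Q ρ) → Transfers P → Transfers Q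
  transfers-⇔ P⇔Q tr = record
    { terms     = terms tr
    ; period    = period tr
    ; formulas  = formulas tr
    ; represent = λ d∈ → let ψ , ψ∈ , rep = represent tr d∈ in
        ψ , ψ∈ , λ u split → rep u split ⇔-∘ ⇔-sym (P⇔Q _)
    }

  transfers-¬ : {P : Pred (Vec Carrier n) ℓ} → Transfers P → Transfers (λ ρ → ¬ P ρ)
  transfers-¬ tr = record
    { terms     = terms tr
    ; period    = period tr
    ; formulas  = List.map ¬̇_ (formulas tr)
    ; represent = λ d∈ → let ψ , ψ∈ , rep = represent tr d∈ in
        ¬̇ ψ , ∈-map⁺ ¬̇_ ψ∈ , λ u split → ¬-cong-⇔ (rep u split)
    }

  module _ (_∙̇_ : Formula OgTerm n → Formula OgTerm n → Formula OgTerm n)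
    {_⊛_ : Set ℓ → Set ℓ → Set ℓ}
    (⊛-cong : ∀ {A B C E} → A ⇔ B → C ⇔ E → (A ⊛ C) ⇔ (B ⊛ E))
    (⊨-∙̇ : ∀ {u φ ψ} → (u ⊨ᴰ (φ ∙̇ ψ)) ≡ ((u ⊨ᴰ φ) ⊛ (u ⊨ᴰ ψ)))
    where

    -- Treats the binary connectives uniformly: a tuple split for the joined term lists and the
    -- product of the periods is split for both arguments.
    transfers-∙̇ : {P Q : Pred (Vec Carrier n) ℓ} → Transfers P → Transfers Q →
                  Transfers (λ ρ → P ρ ⊛ Q ρ)
    transfers-∙̇ {P} {Q} tr tr′ = record
      { terms     = terms tr ++ terms tr′
      ; period    = period tr ℕ.* period tr′
      ; period≢0  = periods≢0
      ; formulas  = cartesianProductWith _∙̇_ (formulas tr) (formulas tr′)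
      ; represent = λ d∈ →
          let φ , φ∈ , repφ = represent tr d∈
              ψ , ψ∈ , repψ = represent tr′ d∈
          in φ ∙̇ ψ , ∈-cartesianProductWith⁺ _∙̇_ φ∈ ψ∈ , λ u split →
             ≡.subst ((P _ ⊛ Q _) ⇔_) (≡.sym ⊨-∙̇)
               (⊛-cong (repφ u (split-weaken ∈-++⁺ˡ (m∣m*n (period tr′)) split))
                       (repψ u (split-weaken (∈-++⁺ʳ (terms tr)) (n∣m*n (period tr)) split)))
      }
      where
      instance
        periods≢0 : NonZero (period tr ℕ.* period tr′)
        periods≢0 = ℕ.m*n≢0 (period tr) (period tr′)

  ⊥̇ : Formula OgTerm n
  ⊥̇ = ¬̇ (𝟎 ≐ 𝟎)

  ¬⊨⊥̇ : (u : Vec Carrier n) → ¬ (u ⊨ᴰ ⊥̇)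
  ¬⊨⊥̇ _ p = p (≈⇒≈ᴰ refl)

  -- One disjunction for each sublist. Which disjuncts are wanted depends on `d`, but the list of
  -- candidates has to stay finite and independent of `d`.
  existentials : List (Formula OgTerm (suc n)) → List (Formula OgTerm n)
  existentials []       = ⊥̇ ∷ []
  existentials (ψ ∷ ψs) = List.map (∃̇ ψ ∨̇_) (existentials ψs) ++ existentials ψs

  -- Excluded middle, applied to each `R ψ` in turn, picks out the sublist of the formulas
  -- satisfying `R`.
  select : (R : Formula OgTerm (suc n) → Set ℓ) → ∀ ψs →
           ∃[ χ ] (χ ∈ existentials ψs ×
                   (∀ u → (u ⊨ᴰ χ) ⇔ (∃[ ψ ] (ψ ∈ ψs × R ψ × ∃[ y ] (y ∷ u ⊨ᴰ ψ)))))
  select R [] = ⊥̇ , here ≡.refl , λ u → mk⇔ (⊥-elim ∘ ¬⊨⊥̇ u) λ ()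
  select R (ψ ∷ ψs) with em {R ψ} | select R ψs
  ... | yes Rψ | χ , χ∈ , χ⇔ = ∃̇ ψ ∨̇ χ , ∈-++⁺ˡ (∈-map⁺ (∃̇ ψ ∨̇_) χ∈) , λ u → mk⇔
    (λ { (inj₁ p) → ψ , here ≡.refl , Rψ , p
       ; (inj₂ p) → let ψ′ , ψ′∈ , q = to (χ⇔ u) p in ψ′ , there ψ′∈ , q })
    (λ { (_ , here ≡.refl , _ , p) → inj₁ p
       ; (ψ′ , there ψ′∈ , q)      → inj₂ (from (χ⇔ u) (ψ′ , ψ′∈ , q)) })
  ... | no ¬Rψ | χ , χ∈ , χ⇔ = χ , ∈-++⁺ʳ (List.map (∃̇ ψ ∨̇_) (existentials ψs)) χ∈ , λ u → mk⇔
    (λ p → let ψ′ , ψ′∈ , q = to (χ⇔ u) p in ψ′ , there ψ′∈ , q)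
    (λ { (_ , here ≡.refl , Rψ , _) → ⊥-elim (¬Rψ Rψ)
       ; (ψ′ , there ψ′∈ , q)       → from (χ⇔ u) (ψ′ , ψ′∈ , q) })

  -- A witness `y` is written as `w + e` with `w` extending the split tuple and `e` in `D`; the
  -- disjunction runs over the formulas that represent `P` for some choice of `e`. Conversely, a
  -- witness modulo `D` is moved to a split `w`, and `w + e` is a witness for `P`.
  transfers-∃ : {P : Pred (Vec Carrier (suc n)) ℓ} →
                (∀ {ρ ρ′} → Pointwise _≈_ ρ ρ′ → P ρ → P ρ′) →
                Transfers P → Transfers (λ ρ → ∃[ y ] P (y ∷ ρ))
  transfers-∃ {n} {P} P-resp tr = record
    { terms     = E.terms
    ; period    = E.period
    ; formulas  = existentials (formulas tr)
    ; represent = λ {d} d∈ →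
        let χ , χ∈ , χ⇔ = select (λ ψ → ∃[ e ] Represents tr ψ (e ∷ d)) (formulas tr)
        in χ , χ∈ , λ u split → mk⇔
             (λ { (y , p) → from (χ⇔ u) (forward d∈ u split y p) })
             (λ u⊨χ → backward u split (to (χ⇔ u) u⊨χ))
    }
    where
    module E = Extend (terms tr) (period tr)

    forward : ∀ {d} → All D d → ∀ u → Split E.terms E.period u → ∀ y → P (y ∷ zipWith _+_ u d) →
              ∃[ ψ ] (ψ ∈ formulas tr × (∃[ e ] Represents tr ψ (e ∷ d)) × ∃[ w ] (w ∷ u ⊨ᴰ ψ))
    forward d∈ u split y p =
      let w , y-w∈ , split′ = E.extend split y
          ψ , ψ∈ , rep      = represent tr (y-w∈ ∷ d∈)
          y≈                = solve (var 0F) (var 1F ⊕ (var 0F ⊕ (⊖ var 1F))) (y ∷ w ∷ [])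
      in ψ , ψ∈ , (y + - w , rep) , w ,
         to (rep (w ∷ u) split′) (P-resp (y≈ ∷ Pointwise.refl refl) p)

    backward : ∀ {d} u → Split E.terms E.period u →
               ∃[ ψ ] (ψ ∈ formulas tr × (∃[ e ] Represents tr ψ (e ∷ d)) × ∃[ y ] (y ∷ u ⊨ᴰ ψ)) →
               ∃[ y ] P (y ∷ zipWith _+_ u d)
    backward u split (ψ , _ , (e , rep) , y , y∷u⊨) =
      let w , y-w∈ , split′ = E.extend split y
      in w + e , from (rep (w ∷ u) split′)
           (⊨ᴰ-cong ψ (y-w∈ ∷ Pointwise.refl (≈⇒≈ᴰ refl)) y∷u⊨)

  module _ (s t : OgTerm n) where

    private
      difference : OgTerm n
      difference = s ⊕ (⊖ t)

      ≈ᴰ⇒≈ : ∀ {u} → Split (difference ∷ []) 1 u → ⟦ s ⟧ u ≈ᴰ ⟦ t ⟧ u → ⟦ s ⟧ u ≈ ⟦ t ⟧ u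
      ≈ᴰ⇒≈ split p = x∙y⁻¹≈ε⇒x≈y _ _ (exact split (here ≡.refl) p)

      ⟦⟧-+≈ᴰ : (r : OgTerm n) → ∀ {d} → All D d → ∀ u → ⟦ r ⟧ (zipWith _+_ u d) ≈ᴰ ⟦ r ⟧ u
      ⟦⟧-+≈ᴰ r d∈ u = ≈ᴰ-trans (≈⇒≈ᴰ (⟦⟧-homo-+ r u _)) (x+d≈ᴰx (⟦⟧-closed r d∈))

    -- For split `u`, equality of `s` and `t` modulo `D` is genuine equality. The equation at
    -- `u + d` therefore amounts to the one at `u` modulo `D` together with the one at `d`, and the
    -- latter is settled by `d` alone.
    transfers-≐ : Transfers (λ ρ → ⟦ s ⟧ ρ ≈ ⟦ t ⟧ ρ)
    transfers-≐ = record
      { terms = difference ∷ [] ; period = 1 ; formulas = s ≐ t ∷ ⊥̇ ∷ [] ; represent = rep }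
      where
      rep : ∀ {d} → All D d → ∃[ ψ ] (ψ ∈ s ≐ t ∷ ⊥̇ ∷ [] ×
            (∀ u → Split (difference ∷ []) 1 u →
               (⟦ s ⟧ (zipWith _+_ u d) ≈ ⟦ t ⟧ (zipWith _+_ u d)) ⇔ (u ⊨ᴰ ψ)))
      rep {d} d∈ = choose em
        where
        mod : ∀ u → ⟦ s ⟧ (zipWith _+_ u d) ≈ ⟦ t ⟧ (zipWith _+_ u d) → ⟦ s ⟧ u ≈ᴰ ⟦ t ⟧ u
        mod u p = ≈ᴰ-trans (≈ᴰ-sym (⟦⟧-+≈ᴰ s d∈ u)) (≈ᴰ-trans (≈⇒≈ᴰ p) (⟦⟧-+≈ᴰ t d∈ u))

        choose : Dec (⟦ s ⟧ d ≈ ⟦ t ⟧ d) → _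
        choose (yes sd≈td) = s ≐ t , here ≡.refl , λ u split → mk⇔ (mod u) λ p →
          trans (⟦⟧-homo-+ s u d)
            (trans (∙-cong (≈ᴰ⇒≈ split p) sd≈td) (sym (⟦⟧-homo-+ t u d)))
        choose (no sd≉td) = ⊥̇ , there (here ≡.refl) , λ u split → mk⇔
          (λ p → ⊥-elim (sd≉td (∙-cancelˡ (⟦ s ⟧ u) _ _
            (trans (sym (⟦⟧-homo-+ s u d)) (trans p (trans (⟦⟧-homo-+ t u d)
              (∙-cong (sym (≈ᴰ⇒≈ split (mod u p))) refl)))))))
          (⊥-elim ∘ ¬⊨⊥̇ u)

    -- Lexicographic comparison: if `s` and `t` differ at `u` modulo `D`, this decides; otherwise
    -- they agree at `u` exactly and the comparison at `d` decides.
    transfers-≺ : Transfers (λ ρ → ⟦ s ⟧ ρ < ⟦ t ⟧ ρ)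
    transfers-≺ = record
      { terms = difference ∷ [] ; period = 1 ; formulas = s ≺ t ∨̇ s ≐ t ∷ s ≺ t ∷ []
      ; represent = rep }
      where
      rep : ∀ {d} → All D d → ∃[ ψ ] (ψ ∈ s ≺ t ∨̇ s ≐ t ∷ s ≺ t ∷ [] ×
            (∀ u → Split (difference ∷ []) 1 u →
               (⟦ s ⟧ (zipWith _+_ u d) < ⟦ t ⟧ (zipWith _+_ u d)) ⇔ (u ⊨ᴰ ψ)))
      rep {d} d∈ = choose em
        where
        module _ (u : Vec Carrier n) where
          S′ = ⟦ s ⟧ (zipWith _+_ u d)
          T′ = ⟦ t ⟧ (zipWith _+_ u d)

          mod : ¬ (⟦ s ⟧ u ≈ᴰ ⟦ t ⟧ u) → S′ < T′ → ⟦ s ⟧ u <ᴰ ⟦ t ⟧ u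
          mod s≉t S′<T′ = <ᴰ-respˡ (⟦⟧-+≈ᴰ s d∈ u) (<ᴰ-respʳ (⟦⟧-+≈ᴰ t d∈ u) (S′<T′ , λ S′≈T′ →
            s≉t (≈ᴰ-trans (≈ᴰ-sym (⟦⟧-+≈ᴰ s d∈ u)) (≈ᴰ-trans S′≈T′ (⟦⟧-+≈ᴰ t d∈ u)))))

          mod⁻ : ⟦ s ⟧ u <ᴰ ⟦ t ⟧ u → S′ < T′
          mod⁻ s<t = proj₁ (<ᴰ-respˡ (≈ᴰ-sym (⟦⟧-+≈ᴰ s d∈ u)) (<ᴰ-respʳ (≈ᴰ-sym (⟦⟧-+≈ᴰ t d∈ u)) s<t))

          module _ (s≈t : ⟦ s ⟧ u ≈ ⟦ t ⟧ u) where
            translate : S′ < T′ → ⟦ s ⟧ d < ⟦ t ⟧ d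
            translate S′<T′ =
              <-respˡ-≈ (solve ((⊖ var 0F) ⊕ (var 0F ⊕ var 1F)) (var 1F) (⟦ s ⟧ u ∷ ⟦ s ⟧ d ∷ []))
                (<-respʳ-≈ (trans (∙-cong (⁻¹-cong s≈t) refl)
                    (solve ((⊖ var 0F) ⊕ (var 0F ⊕ var 1F)) (var 1F) (⟦ t ⟧ u ∷ ⟦ t ⟧ d ∷ [])))
                  (+-monoʳ-< (- ⟦ s ⟧ u)
                    (<-respˡ-≈ (⟦⟧-homo-+ s u d) (<-respʳ-≈ (⟦⟧-homo-+ t u d) S′<T′))))

            translate⁻ : ⟦ s ⟧ d < ⟦ t ⟧ d → S′ < T′
            translate⁻ sd<td = <-respˡ-≈ (sym (⟦⟧-homo-+ s u d))
              (<-respʳ-≈ (trans (∙-cong s≈t refl) (sym (⟦⟧-homo-+ t u d)))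
                (+-monoʳ-< (⟦ s ⟧ u) sd<td))

        choose : Dec (⟦ s ⟧ d < ⟦ t ⟧ d) → _
        choose (yes sd<td) = s ≺ t ∨̇ s ≐ t , here ≡.refl , λ u split → mk⇔
          (λ S′<T′ → forward u S′<T′ em)
          (λ { (inj₁ s<t) → mod⁻ u s<t
             ; (inj₂ s≈t) → translate⁻ u (≈ᴰ⇒≈ split s≈t) sd<td })
          where
          forward : ∀ u → S′ u < T′ u → Dec (⟦ s ⟧ u ≈ᴰ ⟦ t ⟧ u) → u ⊨ᴰ s ≺ t ∨̇ s ≐ t
          forward u S′<T′ (yes s≈t) = inj₂ s≈t
          forward u S′<T′ (no s≉t)  = inj₁ (mod u s≉t S′<T′)
        choose (no sd≮td) = s ≺ t , there (here ≡.refl) , λ u split → mk⇔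
          (λ S′<T′ → mod u (λ s≈t → sd≮td (translate u (≈ᴰ⇒≈ split s≈t) S′<T′)) S′<T′)
          (mod⁻ u)

  transfer : (φ : Formula OgTerm n) → Transfers (_⊨ φ)
  transfer (s ≐ t) = transfers-≐ s t
  transfer (s ≺ t) = transfers-≺ s t
  transfer (¬̇ φ)   = transfers-¬ (transfer φ)
  transfer (φ ∧̇ ψ) = transfers-∙̇ _∧̇_ _×-⇔_ ≡.refl (transfer φ) (transfer ψ)
  transfer (φ ∨̇ ψ) = transfers-∙̇ _∨̇_ _⊎-⇔_ ≡.refl (transfer φ) (transfer ψ)
  transfer (φ ⇒̇ ψ) = transfers-∙̇ _⇒̇_ →-cong-⇔ ≡.refl (transfer φ) (transfer ψ)
  transfer (∃̇ φ)   = transfers-∃ (⊨-cong φ) (transfer φ)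
  transfer (∀̇ φ)   = transfers-⇔ ¬∃¬⇔∀
    (transfers-¬ (transfers-∃ (⊨-cong (¬̇ φ)) (transfers-¬ (transfer φ))))
    where
    ¬∃¬⇔∀ : ∀ ρ → (¬ (∃[ y ] ¬ (y ∷ ρ ⊨ φ))) ⇔ (∀ y → y ∷ ρ ⊨ φ)
    ¬∃¬⇔∀ ρ = mk⇔ (λ ¬∃¬ y → decidable-stable em (λ ¬p → ¬∃¬ (y , ¬p)))
                   (λ p (y , ¬p) → ¬p (p y))

  -- The tail is lifted first, for the stronger requirements that `Extend` imposes, and the head is
  -- then adjusted modulo `D`.
  split-lift : ∀ {m} (ts : List (OgTerm m)) N {{_ : NonZero N}} (c : Vec Carrier m) →
               ∃[ u ] (Split ts N u × Pointwise _≈ᴰ_ c u)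
  split-lift ts N []      = [] , split-[] , []
  split-lift ts N (x ∷ c) =
    let u , split , c≈u   = split-lift E.terms E.period c
        w , x≈w , split′ = E.extend split x
    in w ∷ u , split′ , x≈w ∷ c≈u
    where module E = Extend ts N

  -- The parameters are `u + d` with `u` split, and a point is replaced by a congruent `w` with
  -- `w ∷ u` split; `H` does not notice, as it contains `D`. On such points the defining formula is
  -- represented by a single formula over `G / D`.
  definable-mod : {H : Pred Carrier ℓ} → IsConvexSubgroup G H → D ⊆ H →
                  OgDefinable G H → Definableᴰ H
  definable-mod {H} H-convexSubgroup D⊆H (m , φ , c , H⇔φ) = m , ψ , c , λ x →
    let w , x≈w , split′ = E.extend split x in
    mk⇔
      (λ x∈ → ⊨ᴰ-cong ψ (≈ᴰ-sym x≈w ∷ Pointwise.sym ≈ᴰ-sym c≈u) (to (ψ⇔ w split′) (to (H⇔φ w)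
                (H-resp x≈w x∈))))
      (λ x⊨ψ → H-resp (≈ᴰ-sym x≈w) (from (H⇔φ w) (from (ψ⇔ w split′)
                (⊨ᴰ-cong ψ (x≈w ∷ c≈u) x⊨ψ))))
    where
    open Transfers (transfer φ) using () renaming (terms to ts; period to N; represent to rep)
    instance
      N≢0 : NonZero N
      N≢0 = period≢0 (transfer φ)

    module E = Extend ts N
    module H = ConvexSubgroup H-convexSubgroup

    H-resp : ∀ {x y} → x ≈ᴰ y → H x → H y
    H-resp {x} {y} x≈y x∈ = H.resp-≈
      (solve (var 0F ⊕ (⊖ (var 0F ⊕ (⊖ var 1F)))) (var 1F) (x ∷ y ∷ []))
      (H.-‿closed x∈ (D⊆H x≈y))

    lifted = split-lift E.terms E.period c
    u      = proj₁ lifted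
    split  = proj₁ (proj₂ lifted)
    c≈u    = proj₂ (proj₂ lifted)

    difference : ∀ {k} {c u : Vec Carrier k} → Pointwise _≈ᴰ_ c u →
                 ∃[ d ] (All D d × Pointwise _≈_ c (zipWith _+_ u d))
    difference [] = [] , [] , []
    difference {c = x ∷ _} {u = y ∷ _} (x≈y ∷ c≈u) =
      let d , d∈ , c≈u+d = difference c≈u
      in x + - y ∷ d , x≈y ∷ d∈ ,
         solve (var 0F) (var 1F ⊕ (var 0F ⊕ (⊖ var 1F))) (x ∷ y ∷ []) ∷ c≈u+d

    d     = proj₁ (difference c≈u)
    d∈    = proj₁ (proj₂ (difference c≈u))
    c≈u+d = proj₂ (proj₂ (difference c≈u))

    -- The point `w` itself is tested, so the `D`-part of the first coordinate is `0#`.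
    represented = rep (0∈ ∷ d∈)
    ψ           = proj₁ represented

    ψ⇔ : ∀ w → Split ts N (w ∷ u) → (w ∷ c ⊨ φ) ⇔ (w ∷ u ⊨ᴰ ψ)
    ψ⇔ w split′ = proj₂ (proj₂ represented) (w ∷ u) split′ ⇔-∘ mk⇔
      (⊨-cong φ (sym (identityʳ w) ∷ c≈u+d))
      (⊨-cong φ (identityʳ w ∷ Pointwise.sym sym c≈u+d))

-- Squares in ordered fields and convex valuations.

module OrderedFieldProperties {ℓ : Level} (K : OrderedField ℓ) where
  open OrderedField K public
  open IsStrictTotalOrder isStrictTotalOrder public
    using (compare; <-respˡ-≈; <-respʳ-≈)
  open RingProperties ring using (-‿distribˡ-*; -‿distribʳ-*; -‿involutive)
  open CommutativeSemigroupProperties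
    (CommutativeRing.*-commutativeSemigroup commutativeRing) public using (interchange)
  open SetoidReasoning setoid

  x<0⇒0<-x : ∀ {x} → x < 0# → 0# < - x
  x<0⇒0<-x {x} x<0 =
    <-respˡ-≈ (-‿inverseˡ x) (<-respʳ-≈ (+-identityʳ (- x)) (+-monoʳ-< (- x) x<0))

  0<x*x : ∀ {x} → ¬ (x ≈ 0#) → 0# < x * x
  0<x*x {x} x≉0 with compare 0# x
  ... | tri< 0<x _ _ = *-pos 0<x 0<x
  ... | tri≈ _ 0≈x _ = ⊥-elim (x≉0 (sym 0≈x))
  ... | tri> _ _ x<0 = <-respʳ-≈ (begin
    - x * - x      ≈⟨ -‿distribˡ-* x (- x) ⟨
    - (x * - x)    ≈⟨ -‿cong (-‿distribʳ-* x x) ⟨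
    - - (x * x)    ≈⟨ -‿involutive (x * x) ⟩
    x * x          ∎) (*-pos (x<0⇒0<-x x<0) (x<0⇒0<-x x<0))

  *-monoʳ-< : ∀ {x y z} → 0# < z → x < y → z * x < z * y
  *-monoʳ-< {x} {y} {z} 0<z x<y = <-respˡ-≈ (+-identityʳ (z * x)) (<-respʳ-≈ (begin
    z * x + z * (- x + y)    ≈⟨ distribˡ z x (- x + y) ⟨
    z * (x + (- x + y))      ≈⟨ *-congˡ (+-assoc x (- x) y) ⟨
    z * (x + - x + y)        ≈⟨ *-congˡ (+-congʳ (-‿inverseʳ x)) ⟩
    z * (0# + y)             ≈⟨ *-congˡ (+-identityˡ y) ⟩
    z * y                    ∎)
    (+-monoʳ-< (z * x) (*-pos 0<z (<-respˡ-≈ (-‿inverseˡ x) (+-monoʳ-< (- x) x<y)))))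

module ConvexValuation {ℓ : Level} {K : OrderedField ℓ} {G : OrderedAbelianGroup ℓ}
  (v : Valuation K G) (𝒪-convex : Convex (OrderedField._<_ K) (Valuation.ValuationRing v)) where

  module F = OrderedFieldProperties K
  open F public using () renaming (Carrier to F)
  open OrderedGroupProperties G
  open ExtendedGroup G
  open Valuation v
  open SupEquality _≈_ using (≈⁺-sym; ≈⁺-trans; [≈]-injective; ⊤⁺≈⊤⁺)
    renaming ([_] to ≈[_])

  infix 4 _↦_
  _↦_ : F → Carrier → Set ℓ
  x ↦ g = val x ≈∞ [ g ]

  ↦-unique : ∀ {x g h} → x ↦ g → x ↦ h → g ≈ h
  ↦-unique x↦g x↦h = [≈]-injective (≈⁺-trans trans (≈⁺-sym sym x↦g) x↦h)

  ↦-congˡ : ∀ {x y g} → x F.≈ y → x ↦ g → y ↦ g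
  ↦-congˡ x≈y x↦g = ≈⁺-trans trans (≈⁺-sym sym (val-cong x≈y)) x↦g

  ↦-congʳ : ∀ {x g h} → g ≈ h → x ↦ g → x ↦ h
  ↦-congʳ g≈h x↦g = ≈⁺-trans trans x↦g ≈[ g≈h ]

  ↦⇒≉0 : ∀ {x g} → x ↦ g → ¬ (x F.≈ F.0#)
  ↦⇒≉0 {x} x↦g x≈0 with () ← ≈⁺-trans trans (≈⁺-sym sym (from (val-∞ x) x≈0)) x↦g

  ≉0⇒↦ : ∀ {x} → ¬ (x F.≈ F.0#) → ∃[ g ] x ↦ g
  ≉0⇒↦ {x} x≉0 with val x | to (val-∞ x)
  ... | [ g ] | _  = g , ≈[ refl ]
  ... | ∞     | x≈ = ⊥-elim (x≉0 (x≈ ⊤⁺≈⊤⁺))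

  +∞-cong : ∀ {a b g h} → a ≈∞ [ g ] → b ≈∞ [ h ] → a +∞ b ≈∞ [ g + h ]
  +∞-cong ≈[ p ] ≈[ q ] = ≈[ ∙-cong p q ]

  ↦-* : ∀ {x y g h} → x ↦ g → y ↦ h → x F.* y ↦ g + h
  ↦-* {x} {y} x↦g y↦h = ≈⁺-trans trans (val-* x y) (+∞-cong x↦g y↦h)

  1↦0 : F.1# ↦ 0#
  1↦0 with g , 1↦g ← ≉0⇒↦ (F.0≉1 ∘ F.sym) =
    ↦-congʳ (∙-cancelˡ g g 0# (trans g+g≈g (sym (identityʳ g)))) 1↦g
    where
    g+g≈g = ↦-unique (↦-congˡ (F.*-identityˡ F.1#) (↦-* 1↦g 1↦g)) 1↦g

  0≤∞∧≈⇒0≤ : ∀ {a g} → a ≈∞ [ g ] → [ 0# ] ≤∞ a → 0# ≤ g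
  0≤∞∧≈⇒0≤ ≈[ g≈ ] ≤[ inj₁ 0<g ] = inj₁ (<-respʳ-≈ g≈ 0<g)
  0≤∞∧≈⇒0≤ ≈[ g≈ ] ≤[ inj₂ 0≈g ] = inj₂ (trans 0≈g g≈)

  ↦⇒∈𝒪 : ∀ {x g} → x ↦ g → 0# ≤ g → ValuationRing x
  ↦⇒∈𝒪 x↦g 0≤g = aux x↦g 0≤g
    where
    aux : ∀ {a g} → a ≈∞ [ g ] → 0# ≤ g → [ 0# ] ≤∞ a
    aux ≈[ g≈ ] (inj₁ 0<g) = ≤[ inj₁ (<-respʳ-≈ (sym g≈) 0<g) ]
    aux ≈[ g≈ ] (inj₂ 0≈g) = ≤[ inj₂ (trans 0≈g (sym g≈)) ]

  0<∞∧≈⇒0< : ∀ {a g} → a ≈∞ [ g ] → [ 0# ] <∞ a → 0# < g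
  0<∞∧≈⇒0< ≈[ g≈ ] <[ 0<g ] = <-respʳ-≈ g≈ 0<g

  0<⇒0<∞ : ∀ {a g} → a ≈∞ [ g ] → 0# < g → [ 0# ] <∞ a
  0<⇒0<∞ ≈[ g≈ ] 0<g = <[ <-respʳ-≈ (sym g≈) 0<g ]

  0<∞-0 : ∀ {x} → x F.≈ F.0# → [ 0# ] <∞ val x
  0<∞-0 {x} x≈0 = aux (from (val-∞ x) x≈0)
    where
    aux : ∀ {a} → a ≈∞ ∞ → [ 0# ] <∞ a
    aux ⊤⁺≈⊤⁺ = [ _ ]<⊤⁺

  0∈𝒪 : ValuationRing F.0#
  0∈𝒪 = aux (from (val-∞ F.0#) F.refl)
    where
    aux : ∀ {a} → a ≈∞ ∞ → [ 0# ] ≤∞ a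
    aux ⊤⁺≈⊤⁺ = _ ≤⊤⁺

  -- Squares stand in for absolute values. If `y` had the smaller square, the square of the quotient
  -- of `y` by `x` would lie between 0 and 1, hence in the convex valuation ring, although its value
  -- is negative.
  square-< : ∀ {x y g h} → x ↦ g → y ↦ h → h < g → x F.* x F.< y F.* y
  square-< {x} {y} {g} {h} x↦g y↦h h<g with F.compare (x F.* x) (y F.* y)
  ... | tri< x²<y² _ _ = x²<y²
  ... | tri≈ _ x²≈y² _ =
    ⊥-elim (irrefl (↦-unique (↦-* y↦h y↦h) (↦-congˡ x²≈y² (↦-* x↦g x↦g))) (+-mono-< h<g h<g))
  ... | tri> _ _ y²<x² = ⊥-elim (absurd (0≤∞∧≈⇒0≤ (↦-* z↦ z↦) z²∈𝒪))
    where
    w = proj₁ (F.inverse x (↦⇒≉0 x↦g))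

    x*w≈1 : x F.* w F.≈ F.1#
    x*w≈1 = proj₂ (F.inverse x (↦⇒≉0 x↦g))

    w≉0 : ¬ (w F.≈ F.0#)
    w≉0 w≈0 = F.0≉1 (F.trans (F.sym (F.zeroʳ x)) (F.trans (F.*-congˡ (F.sym w≈0)) x*w≈1))

    k = proj₁ (≉0⇒↦ w≉0)

    g+k≈0 : g + k ≈ 0#
    g+k≈0 = ↦-unique (↦-congˡ x*w≈1 (↦-* x↦g (proj₂ (≉0⇒↦ w≉0)))) 1↦0

    z = w F.* y

    z↦ : z ↦ k + h
    z↦ = ↦-* (proj₂ (≉0⇒↦ w≉0)) y↦h

    z²<1 : z F.* z F.< F.1#
    z²<1 = F.<-respˡ-≈ (F.interchange w w y y)
      (F.<-respʳ-≈ (F.trans (F.interchange w w x x) (F.trans (F.*-cong w*x≈1 w*x≈1) (F.*-identityˡ F.1#)))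
        (F.*-monoʳ-< (F.0<x*x w≉0) y²<x²))
      where w*x≈1 = F.trans (F.*-comm w x) x*w≈1

    z²∈𝒪 : ValuationRing (z F.* z)
    z²∈𝒪 = 𝒪-convex 0∈𝒪 (↦⇒∈𝒪 1↦0 (inj₂ refl)) (F.0<x*x (↦⇒≉0 z↦)) z²<1

    k+h<0 : k + h < 0#
    k+h<0 = <-respʳ-≈ (trans (comm k g) g+k≈0) (+-monoʳ-< k h<g)

    absurd : ¬ (0# ≤ (k + h) + (k + h))
    absurd (inj₁ 0<) = asym 0< (<-respʳ-≈ (identityʳ 0#) (+-mono-< k+h<0 k+h<0))
    absurd (inj₂ 0≈) = irrefl (sym 0≈) (<-respʳ-≈ (identityʳ 0#) (+-mono-< k+h<0 k+h<0))

  -- Elements of equal value can compare either way, so the converse is restricted to distinct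
  -- values.
  square-<-⇔ : ∀ {x y g h} → x ↦ g → y ↦ h → ¬ (g ≈ h) → (x F.* x F.< y F.* y) ⇔ (h < g)
  square-<-⇔ {x} {y} {g} {h} x↦g y↦h g≉h = mk⇔ reflect (square-< x↦g y↦h)
    where
    open IsStrictTotalOrder F.isStrictTotalOrder using () renaming (asym to F-asym)

    reflect : x F.* x F.< y F.* y → h < g
    reflect x²<y² with compare h g
    ... | tri< h<g _ _ = h<g
    ... | tri≈ _ h≈g _ = ⊥-elim (g≉h (sym h≈g))
    ... | tri> _ _ g<h = ⊥-elim (F-asym x²<y² (square-< y↦h x↦g g<h))

-- The convex subgroup stabilising a cut.

module CutStabiliser {ℓ : Level} (G : OrderedAbelianGroup ℓ) (n : ℕ) (a : OrderedAbelianGroup.Carrier G) where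

  open OrderedGroupProperties G

  Above : Pred Carrier ℓ
  Above g = a < suc n · g

  above-cong : ∀ {g h} → g ≈ h → Above g ⇔ Above h
  above-cong g≈h = mk⇔ (<-respʳ-≈ (×-congʳ (suc n) g≈h)) (<-respʳ-≈ (×-congʳ (suc n) (sym g≈h)))

  above-mono : ∀ {g h} → g < h → Above g → Above h
  above-mono g<h a<ng = <-trans a<ng (·-mono-< n g<h)

  -- The invariance group of the cut a / (n + 1) of G; when a is not divisible
  -- by n + 1, it is the largest convex subgroup modulo which this persists.
  Stabiliser : Pred Carrier ℓ
  Stabiliser h = ∀ g → Above g ⇔ Above (g + h)

  stabiliser-convexSubgroup : IsConvexSubgroup G Stabiliser
  stabiliser-convexSubgroup = record
    { resp-≈     = λ x≈y x∈ g → above-cong (∙-cong refl x≈y) ⇔-∘ x∈ g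
    ; 0∈         = λ g → above-cong (sym (identityʳ g))
    ; +-closed   = λ {x} {y} x∈ y∈ g → above-cong (assoc g x y) ⇔-∘ (y∈ (g + x) ⇔-∘ x∈ g)
    ; neg-closed = λ {x} x∈ g → ⇔-sym (above-cong
        (solve ((var 0F ⊕ (⊖ var 1F)) ⊕ var 1F) (var 0F) (g ∷ x ∷ [])) ⇔-∘ x∈ (g + - x))
    ; convex     = λ x∈ z∈ x<y y<z g → mk⇔
        (above-mono (+-monoʳ-< g x<y) ∘ to (x∈ g))
        (from (z∈ g) ∘ above-mono (+-monoʳ-< g y<z))
    }

  -- Substituting `g + - (y + q)` for `g` removes the subtraction. The summand `q` leaves room for
  -- the common denominator of two terms read in the field.
  stabiliser-difference : ∀ {x y} q → Stabiliser (x + - y) ⇔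
                          (∀ g → Above (g + (y + q)) ⇔ Above (g + (x + q)))
  stabiliser-difference {x} {y} q = mk⇔
    (λ x-y∈ g → above-cong
        (solve ((var 0F ⊕ (var 2F ⊕ var 3F)) ⊕ (var 1F ⊕ (⊖ var 2F))) (var 0F ⊕ (var 1F ⊕ var 3F))
               (g ∷ x ∷ y ∷ q ∷ []))
      ⇔-∘ x-y∈ (g + (y + q)))
    (λ shift g → above-cong
        (solve ((var 0F ⊕ (⊖ (var 2F ⊕ var 3F))) ⊕ (var 1F ⊕ var 3F)) (var 0F ⊕ (var 1F ⊕ (⊖ var 2F)))
               (g ∷ x ∷ y ∷ q ∷ []))
      ⇔-∘ (shift (g + - (y + q))
      ⇔-∘ above-cong
        (solve (var 0F) ((var 0F ⊕ (⊖ (var 1F ⊕ var 2F))) ⊕ (var 1F ⊕ var 2F)) (g ∷ y ∷ q ∷ []))))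

  module _ {H : Pred Carrier ℓ} (H-convexSubgroup : IsConvexSubgroup G H) (a∈H : H a) where
    private
      module H = ConvexSubgroup H-convexSubgroup
      module S = ConvexSubgroup stabiliser-convexSubgroup

      -- Translating `0#` by `h`, or by `- h` if `a < 0#`, cannot cross the cut. This bounds
      -- `suc n · h` by the absolute value of `a`, and convexity of `H` followed by division gives
      -- the claim.
      positive : ∀ {h} → 0# < h → Stabiliser h → H h
      positive {h} 0<h h∈ = H.·⁻-closed (suc n) (bounded (compare a 0#))
        where
        0<nh : 0# < suc n · h
        0<nh = 0<x⇒0<[1+k]x n 0<h

        above-0⇒a<0 : Above 0# → a < 0#
        above-0⇒a<0 = <-respʳ-≈ (·-0# (suc n))

        ¬a<0⇒ : ¬ (a < 0#) → suc n · h ≤ a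
        ¬a<0⇒ a≮0 with compare a (suc n · h)
        ... | tri< a<nh _ _ = ⊥-elim (a≮0 (above-0⇒a<0
                                (from (h∈ 0#) (from (above-cong (identityˡ h)) a<nh))))
        ... | tri≈ _ a≈nh _ = inj₂ (sym a≈nh)
        ... | tri> _ _ nh<a = inj₁ nh<a

        bounded : Tri (a < 0#) (a ≈ 0#) (0# < a) → H (suc n · h)
        bounded (tri< a<0 _ _) = H.convex H.0∈ (H.neg-closed a∈H) 0<nh
          (<-respˡ-≈ (solve (⊖ (⊖ var 0F)) (var 0F) (suc n · h ∷ []))
            (neg-mono-< (<-respʳ-≈ (·-neg (suc n) h) (to (above-cong (identityˡ (- h)))
              (to (S.neg-closed h∈ 0#) (<-respʳ-≈ (sym (·-0# (suc n))) a<0))))))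
        bounded (tri≈ a≮0 _ _) = H.convex-≤ H.0∈ a∈H 0<nh (¬a<0⇒ a≮0)
        bounded (tri> a≮0 _ _) = H.convex-≤ H.0∈ a∈H 0<nh (¬a<0⇒ a≮0)

    stabiliser⊆ : Stabiliser ⊆ H
    stabiliser⊆ {h} h∈ with compare 0# h
    ... | tri< 0<h _ _ = positive 0<h h∈
    ... | tri≈ _ 0≈h _ = H.resp-≈ 0≈h H.0∈
    ... | tri> _ _ h<0 = H.neg⁻-closed
      (positive (<-respˡ-≈ ε⁻¹≈ε (neg-mono-< h<0)) (S.neg-closed h∈))

-- Interpretation of the quotient `G / D` in the field.

private
  variable
    m : ℕ

module Interpretation {ℓ : Level} {K : OrderedField ℓ} {G : OrderedAbelianGroup ℓ}
  (v : Valuation K G) (𝒪-convex : Convex (OrderedField._<_ K) (Valuation.ValuationRing v))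
  (p : ℕ) (a : OrderedAbelianGroup.Carrier G)
  (a∉pG : ∀ g → ¬ (OrderedAbelianGroup._≈_ G (OrderedAbelianGroup._·_ G (suc p) g) a))
  where

  open OrderedGroupProperties G
  open ConvexValuation v 𝒪-convex
  open Valuation v using (surjective)
  open CutStabiliser G p a
  open Quotient G stabiliser-convexSubgroup
  open Semantics F._≈_ F._<_ ⟦ K ⟧or using () renaming (_⊨_ to _⊨ᴷ_)

  ⟦_⟧ᴷ : OrTerm n → Vec F n → F
  ⟦_⟧ᴷ = ⟦ K ⟧or

  -- A term of the group is read multiplicatively in K as num / den.
  num den : (Fin n → Fin m) → OgTerm n → OrTerm m
  num σ (var i) = var (σ i)
  num σ (s ⊕ t) = num σ s ⊗ num σ t
  num σ (⊖ t)   = den σ t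
  num σ 𝟎       = 𝟏
  den σ (var i) = 𝟏
  den σ (s ⊕ t) = den σ s ⊗ den σ t
  den σ (⊖ t)   = num σ t
  den σ 𝟎       = 𝟏

  denominator : OgTerm n → Vec Carrier n → Carrier
  denominator (var i) ρ = 0#
  denominator (s ⊕ t) ρ = denominator s ρ + denominator t ρ
  denominator (⊖ t)   ρ = ⟦ t ⟧ ρ + denominator t ρ
  denominator 𝟎       ρ = 0#

  -- Cross-multiplication: `cross σ s t` and `cross σ t s` have the values of `s` and `t` shifted by
  -- one common amount.
  cross : (Fin n → Fin m) → OgTerm n → OgTerm n → OrTerm m
  cross σ s t = num σ s ⊗ den σ t

  power : OrTerm n → ℕ → OrTerm n
  power t zero    = 𝟏
  power t (suc k) = t ⊗ power t k

  infix 8 _≪_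
  _≪_ : OrTerm n → OrTerm n → Formula OrTerm n
  s ≪ t = (s ⊗ s) ≺ (t ⊗ t)

  ≢0 : OrTerm n → Formula OrTerm n
  ≢0 t = ¬̇ (t ≐ 𝟎)

  -- Expresses `Above` for the value `g` of `t`. As `a` is never `suc p · g`, the two values
  -- compared are distinct and the comparison of squares is faithful.
  above : Fin n → OrTerm n → Formula OrTerm n
  above i t = power t (suc p) ≪ var i

  -- Congruence modulo the stabiliser in the subtraction-free form of `stabiliser-difference`; the
  -- nonzero elements bound by the quantifier take all values in `G`.
  same : (Fin n → Fin m) → Fin m → OgTerm n → OgTerm n → Formula OrTerm m
  same σ i s t = ∀̇ (≢0 (var zero) ⇒̇ (above (suc i) y ⇒̇ above (suc i) x) ∧̇
                                     (above (suc i) x ⇒̇ above (suc i) y))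
    where
    x = var zero ⊗ cross (suc ∘ σ) s t
    y = var zero ⊗ cross (suc ∘ σ) t s

  -- σ locates the variables of the given formula in K, and i locates an element
  -- of value a.
  translate : (Fin n → Fin m) → Fin m → Formula OgTerm n → Formula OrTerm m
  translate σ i (s ≐ t) = same σ i s t
  -- The order is reversed, since the larger value belongs to the smaller absolute value.
  translate σ i (s ≺ t) = cross σ t s ≪ cross σ s t ∧̇ ¬̇ same σ i s t
  translate σ i (¬̇ φ)   = ¬̇ translate σ i φ
  translate σ i (φ ∧̇ ψ) = translate σ i φ ∧̇ translate σ i ψ
  translate σ i (φ ∨̇ ψ) = translate σ i φ ∨̇ translate σ i ψ
  translate σ i (φ ⇒̇ ψ) = translate σ i φ ⇒̇ translate σ i ψ
  translate σ i (∀̇ φ)   = ∀̇ (≢0 (var zero) ⇒̇ translate (lift 1 σ) (suc i) φ)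
  translate σ i (∃̇ φ)   = ∃̇ (≢0 (var zero) ∧̇ translate (lift 1 σ) (suc i) φ)

  record Lifts (σ : Fin n → Fin m) (i : Fin m) (γ : Vec F m) (ρ : Vec Carrier n) : Set ℓ where
    field
      variables : ∀ j → lookup γ (σ j) ↦ lookup ρ j
      cut       : lookup γ i ↦ a

  open Lifts

  lifts-∷ : ∀ {σ : Fin n → Fin m} {i γ ρ x g} → x ↦ g → Lifts σ i γ ρ →
            Lifts (lift 1 σ) (suc i) (x ∷ γ) (g ∷ ρ)
  lifts-∷ x↦g lifts = record
    { variables = λ { zero → x↦g ; (suc j) → variables lifts j }
    ; cut       = cut lifts
    }

  lifts-weaken : ∀ {σ : Fin n → Fin m} {i γ ρ} x → Lifts σ i γ ρ → Lifts (suc ∘ σ) (suc i) (x ∷ γ) ρ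
  lifts-weaken x lifts = record { variables = variables lifts ; cut = cut lifts }

  module _ {σ : Fin n → Fin m} {i : Fin m} {γ : Vec F m} {ρ : Vec Carrier n} (lifts : Lifts σ i γ ρ) where

    den-↦ : ∀ t → ⟦ den σ t ⟧ᴷ γ ↦ denominator t ρ
    num-↦ : ∀ t → ⟦ num σ t ⟧ᴷ γ ↦ ⟦ t ⟧ ρ + denominator t ρ
    den-↦ (var j) = 1↦0
    den-↦ (s ⊕ t) = ↦-* (den-↦ s) (den-↦ t)
    den-↦ (⊖ t)   = num-↦ t
    den-↦ 𝟎       = 1↦0
    num-↦ (var j) = ↦-congʳ (sym (identityʳ _)) (variables lifts j)
    num-↦ (s ⊕ t) = ↦-congʳ
      (solve ((var 0F ⊕ var 1F) ⊕ (var 2F ⊕ var 3F)) ((var 0F ⊕ var 2F) ⊕ (var 1F ⊕ var 3F))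
             (⟦ s ⟧ ρ ∷ denominator s ρ ∷ ⟦ t ⟧ ρ ∷ denominator t ρ ∷ []))
      (↦-* (num-↦ s) (num-↦ t))
    num-↦ (⊖ t)   = ↦-congʳ
      (solve (var 1F) ((⊖ var 0F) ⊕ (var 0F ⊕ var 1F)) (⟦ t ⟧ ρ ∷ denominator t ρ ∷ []))
      (den-↦ t)
    num-↦ 𝟎       = ↦-congʳ (sym (identityʳ 0#)) 1↦0

    cross-↦ : ∀ s t → ⟦ cross σ s t ⟧ᴷ γ ↦ ⟦ s ⟧ ρ + (denominator s ρ + denominator t ρ)
    cross-↦ s t = ↦-congʳ (assoc _ _ _) (↦-* (num-↦ s) (den-↦ t))

    cross-↦′ : ∀ s t → ⟦ cross σ t s ⟧ᴷ γ ↦ ⟦ t ⟧ ρ + (denominator s ρ + denominator t ρ)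
    cross-↦′ s t = ↦-congʳ (∙-cong refl (comm _ _)) (cross-↦ t s)

  power-↦ : ∀ (t : OrTerm m) k {γ g} → ⟦ t ⟧ᴷ γ ↦ g → ⟦ power t k ⟧ᴷ γ ↦ k · g
  power-↦ t zero    t↦g = 1↦0
  power-↦ t (suc k) t↦g = ↦-* t↦g (power-↦ t k t↦g)

  above-⇔ : ∀ (i : Fin m) (t : OrTerm m) {γ g} → lookup γ i ↦ a → ⟦ t ⟧ᴷ γ ↦ g →
            (γ ⊨ᴷ above i t) ⇔ Above g
  above-⇔ i t {g = g} α↦a t↦g = square-<-⇔ (power-↦ t (suc p) t↦g) α↦a (a∉pG g)

  same-⇔ : ∀ {σ : Fin n → Fin m} {i γ ρ} → Lifts σ i γ ρ → ∀ s t →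
           (γ ⊨ᴷ same σ i s t) ⇔ (⟦ s ⟧ ρ ≈ᴰ ⟦ t ⟧ ρ)
  same-⇔ {σ = σ} {i} {γ} {ρ} lifts s t = mk⇔ forward backward
    where
    q = denominator s ρ + denominator t ρ

    x = var zero ⊗ cross (suc ∘ σ) s t
    y = var zero ⊗ cross (suc ∘ σ) t s

    above-x : ∀ {z g} → z ↦ g → (z ∷ γ ⊨ᴷ above (suc i) x) ⇔ Above (g + (⟦ s ⟧ ρ + q))
    above-x {z} z↦g = above-⇔ (suc i) x (cut lifts) (↦-* z↦g (cross-↦ (lifts-weaken z lifts) s t))

    above-y : ∀ {z g} → z ↦ g → (z ∷ γ ⊨ᴷ above (suc i) y) ⇔ Above (g + (⟦ t ⟧ ρ + q))
    above-y {z} z↦g = above-⇔ (suc i) y (cut lifts) (↦-* z↦g (cross-↦′ (lifts-weaken z lifts) s t))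

    forward : γ ⊨ᴷ same σ i s t → ⟦ s ⟧ ρ ≈ᴰ ⟦ t ⟧ ρ
    forward holds = from (stabiliser-difference q) shift
      where
      shift : ∀ g → Above (g + (⟦ t ⟧ ρ + q)) ⇔ Above (g + (⟦ s ⟧ ρ + q))
      shift g with z , z↦g ← surjective g with y⇒x , x⇒y ← holds z (↦⇒≉0 z↦g) =
        mk⇔ (to (above-x z↦g) ∘ y⇒x ∘ from (above-y z↦g))
            (to (above-y z↦g) ∘ x⇒y ∘ from (above-x z↦g))

    backward : ⟦ s ⟧ ρ ≈ᴰ ⟦ t ⟧ ρ → γ ⊨ᴷ same σ i s t
    backward s≈t z z≉0 =
      let g , z↦g = ≉0⇒↦ z≉0
          shift   = to (stabiliser-difference q) s≈t g
      in from (above-x z↦g) ∘ to shift ∘ to (above-y z↦g) ,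
         from (above-y z↦g) ∘ from shift ∘ to (above-x z↦g)

  -- The quantifier cases rest on the valuation mapping the nonzero elements of the field onto `G`.
  translate-⇔ : ∀ {σ : Fin n → Fin m} {i γ ρ} → Lifts σ i γ ρ → ∀ φ →
                (γ ⊨ᴷ translate σ i φ) ⇔ (ρ ⊨ᴰ φ)
  translate-⇔ lifts (s ≐ t) = same-⇔ lifts s t
  translate-⇔ {σ = σ} {i} {γ} {ρ} lifts (s ≺ t) = mk⇔
    (λ (t≪s , ¬same) → let s≉t = ¬same ∘ from (same-⇔ lifts s t) in
      cancel (to (order (s≉t ∘ ≈⇒≈ᴰ)) t≪s) , s≉t)
    (λ (s<t , s≉t) →
      from (order (s≉t ∘ ≈⇒≈ᴰ)) (+-monoˡ-< q s<t) , s≉t ∘ to (same-⇔ lifts s t))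
    where
    q = denominator s ρ + denominator t ρ

    order : ¬ (⟦ s ⟧ ρ ≈ ⟦ t ⟧ ρ) →
            (γ ⊨ᴷ cross σ t s ≪ cross σ s t) ⇔ (⟦ s ⟧ ρ + q < ⟦ t ⟧ ρ + q)
    order s≉t = square-<-⇔ (cross-↦′ lifts s t) (cross-↦ lifts s t)
      (s≉t ∘ sym ∘ ∙-cancelʳ q _ _)

    cancel : ⟦ s ⟧ ρ + q < ⟦ t ⟧ ρ + q → ⟦ s ⟧ ρ < ⟦ t ⟧ ρ
    cancel s+q<t+q = <-respˡ-≈ (x+q-q (⟦ s ⟧ ρ)) (<-respʳ-≈ (x+q-q (⟦ t ⟧ ρ)) (+-monoˡ-< (- q) s+q<t+q))
      where
      x+q-q : ∀ x → x + q + - q ≈ x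
      x+q-q x = solve ((var 0F ⊕ var 1F) ⊕ (⊖ var 1F)) (var 0F) (x ∷ q ∷ [])
  translate-⇔ lifts (¬̇ φ)   = ¬-cong-⇔ (translate-⇔ lifts φ)
  translate-⇔ lifts (φ ∧̇ ψ) = translate-⇔ lifts φ ×-⇔ translate-⇔ lifts ψ
  translate-⇔ lifts (φ ∨̇ ψ) = translate-⇔ lifts φ ⊎-⇔ translate-⇔ lifts ψ
  translate-⇔ lifts (φ ⇒̇ ψ) = →-cong-⇔ (translate-⇔ lifts φ) (translate-⇔ lifts ψ)
  translate-⇔ lifts (∀̇ φ)   = mk⇔
    (λ holds g → let x , x↦g = surjective g in
      to (translate-⇔ (lifts-∷ x↦g lifts) φ) (holds x (↦⇒≉0 x↦g)))
    (λ holds x x≉0 → let g , x↦g = ≉0⇒↦ x≉0 in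
      from (translate-⇔ (lifts-∷ x↦g lifts) φ) (holds g))
  translate-⇔ lifts (∃̇ φ)   = mk⇔
    (λ (x , x≉0 , holds) → let g , x↦g = ≉0⇒↦ x≉0 in
      g , to (translate-⇔ (lifts-∷ x↦g lifts) φ) holds)
    (λ (g , holds) → let x , x↦g = surjective g in
      x , ↦⇒≉0 x↦g , from (translate-⇔ (lifts-∷ x↦g lifts) φ) holds)

  coarsening-definable : ExcludedMiddle ℓ → {H : Pred Carrier ℓ} → IsConvexSubgroup G H → H a →
                         Definableᴰ H → OrDefinable K (CoarseningRing v H)
  coarsening-definable em {H} H-convexSubgroup a∈H (k , ψ , params , H⇔ψ) =
    suc k , φ , α ∷ map lift-param params , λ x → φ-⇔ x em
    where
    open IsConvexSubgroup H-convexSubgroup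

    α = proj₁ (surjective a)

    lift-param : Carrier → F
    lift-param g = proj₁ (surjective g)

    -- Index 1 is reserved for `α`, so the parameters of `ψ` are shifted past it.
    σ : Fin (suc k) → Fin (suc (suc k))
    σ zero    = zero
    σ (suc j) = suc (suc j)

    -- Having square below 1 does not exclude value `0#`, so the second disjunct asks for a value
    -- outside the stabiliser. Positive values inside it lie in `H` and fall under the third
    -- disjunct.
    φ : Formula OrTerm (suc (suc k))
    φ = var zero ≐ 𝟎
      ∨̇ (var zero ≪ 𝟏 ∧̇ ¬̇ same σ (suc zero) (var zero) 𝟎)
      ∨̇ (≢0 (var zero) ∧̇ translate σ (suc zero) ψ)

    module _ {x g} (x↦g : x ↦ g) where
      γ = x ∷ α ∷ map lift-param params

      lifts : Lifts σ (suc zero) γ (g ∷ params)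
      lifts = record
        { variables = λ { zero    → x↦g
                        ; (suc j) → ≡.subst (_↦ lookup params j) (≡.sym (lookup-map j lift-param params))
                                      (proj₂ (surjective (lookup params j))) }
        ; cut       = proj₂ (surjective a)
        }

      g∈H⇒ : H g → γ ⊨ᴷ φ
      g∈H⇒ g∈H = inj₂ (inj₂ (↦⇒≉0 x↦g , from (translate-⇔ lifts ψ) (to (H⇔ψ g) g∈H)))

      0<g⇒ : 0# < g → Dec (Stabiliser (g + - 0#)) → γ ⊨ᴷ φ
      0<g⇒ 0<g (yes g≈0) = g∈H⇒ (resp-≈ (solve (var 0F ⊕ (⊖ 𝟎)) (var 0F) (g ∷ []))
                             (stabiliser⊆ H-convexSubgroup a∈H g≈0))
      0<g⇒ 0<g (no g≉0)  = inj₂ (inj₁ (square-< x↦g 1↦0 0<g ,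
                             g≉0 ∘ to (same-⇔ lifts (var zero) 𝟎)))

      forward : CoarseningRing v H x → γ ⊨ᴷ φ
      forward (inj₁ 0<v)              = 0<g⇒ (0<∞∧≈⇒0< x↦g 0<v) em
      forward (inj₂ (h , h∈H , x↦h)) = g∈H⇒ (resp-≈ (↦-unique x↦h x↦g) h∈H)

      backward : γ ⊨ᴷ φ → CoarseningRing v H x
      backward (inj₁ x≈0) = ⊥-elim (↦⇒≉0 x↦g x≈0)
      backward (inj₂ (inj₁ (x²<1 , ¬same))) =
        inj₁ (0<⇒0<∞ x↦g (to (square-<-⇔ x↦g 1↦0 λ g≈0 →
          ¬same (from (same-⇔ lifts (var zero) 𝟎) (≈⇒≈ᴰ g≈0))) x²<1))
      backward (inj₂ (inj₂ (_ , holds))) =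
        inj₂ (g , from (H⇔ψ g) (to (translate-⇔ lifts ψ) holds) , x↦g)

    φ-⇔ : ∀ x → Dec (x F.≈ F.0#) →
          CoarseningRing v H x ⇔ (x ∷ α ∷ map lift-param params ⊨ᴷ φ)
    φ-⇔ x (yes x≈0) = mk⇔ (λ _ → inj₁ x≈0) (λ _ → inj₁ (0<∞-0 x≈0))
    φ-⇔ x (no x≉0)  = let g , x↦g = ≉0⇒↦ x≉0 in mk⇔ (forward x↦g) (backward x↦g)

-- An indivisible element of `H` and the resulting definition of the coarsening.

theorem5p3 : ∀ {ℓ : Level} → ExcludedMiddle ℓ →
    (K : OrderedField ℓ) (G : OrderedAbelianGroup ℓ) (v : Valuation K G) →
    IsNatural v →
    (G₀ H : Pred (OrderedAbelianGroup.Carrier G) ℓ) →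
    IsMaximalDivisibleConvexSubgroup G G₀ →
    IsConvexSubgroup G H →
    OgDefinable G H →
    G₀ ⊂ H →
    OrDefinable K (CoarseningRing v H)
theorem5p3 {ℓ} em K G v v-natural G₀ H G₀-maximal H-convexSubgroup H-definable (G₀⊆H , H⊈G₀) =
  conclude (decidable-stable em ¬¬indivisible)
  where
  open OrderedGroupProperties G

  Indivisible : Set ℓ
  Indivisible = ∃[ p ] ∃[ a ] (H a × (∀ g → ¬ (suc p · g ≈ a)))

  -- Otherwise `H` would be divisible, since quotients found in `G` stay in `H` by `·⁻-closed`;
  -- maximality of `G₀` would then force `H` into `G₀`.
  ¬¬indivisible : ¬ ¬ Indivisible
  ¬¬indivisible ¬ind = H⊈G₀
    (IsMaximalDivisibleConvexSubgroup.maximal G₀-maximal H-convexSubgroup H-divisible G₀⊆H)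
    where
    H-divisible : IsDivisible G H
    H-divisible p {a} a∈H =
      let g , pg≈a = decidable-stable em λ ¬div → ¬ind (p , a , a∈H , λ g pg≈a → ¬div (g , pg≈a))
      in g , ConvexSubgroup.·⁻-closed H-convexSubgroup (suc p)
               (IsConvexSubgroup.resp-≈ H-convexSubgroup (sym pg≈a) a∈H) , pg≈a

  conclude : Indivisible → OrDefinable K (CoarseningRing v H)
  conclude (p , a , a∈H , a∉pG) =
    coarsening-definable em H-convexSubgroup a∈H
      (definable-mod H-convexSubgroup (stabiliser⊆ H-convexSubgroup a∈H) H-definable)
    where
    open CutStabiliser G p a
    open Interpretation v (IsNatural.convex v-natural) p a a∉pG
    open Transfer em G stabiliser-convexSubgroup
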